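{- Suppose $pn\to\infty$ and $q\ln n\to\infty$ as $n\to\infty$, where $q=1-p$. Then for every $\varepsilon>0$ there exists $n_0$ such that for all $n\ge n_0$, $$u_2(n,p)\le(2+\varepsilon)\log_{\frac{1}{1-p}}(np)\quad\text{and}\quad u_2'(n,p)\le(2+\varepsilon)\log_{\frac{1}{1-p}}(np).$$
   Context: $G(n,p)$ is the Erdős–Rényi random graph on $n$ labelled vertices (vertex set $V$), each edge present independently with probability $p=p(n)$; $\mathbb{P}_{n,p}$ is the corresponding probability and $q=1-p$. A diameter graph in $\mathbb{R}^d$ is a graph $(V,E)$ with $V\subset\mathbb{R}^d$ finite and $E=\{\{\mathbf{x},\mathbf{y}\}\subseteq V: |\mathbf{x}-\mathbf{y}|=\operatorname{diam}V\}$, where $\operatorname{diam}V=\max_{\mathbf{x},\mathbf{y}\in V}|\mathbf{x}-\mathbf{y}|$ (Euclidean norm); a graph is a diameter graph in $\mathbb{R}^d$ if it is isomorphic to one. $u_d(n,p)$ is the largest positive integer $k$ such that $\mathbb{P}_{n,p}\big(\exists W\subseteq V,\ |W|=k,\ G[W]$ is a diameter graph in $\mathbb{R}^d$ and $\chi(G[W])=d+1\big)>\frac12$, where $G[W]$ is the induced subgraph; if no such $k$ exists, $u_d(n,p)=0$. $u_d'(n,p)$ is defined identically with the additional requirement that $G[W]$ be connected. -}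

module Defs where

open import Algebra.Bundles using (CommutativeRing; Semiring)
import Algebra.Definitions.RawSemiring as RawSemiringDefs
open import Axiom.ExcludedMiddle using (ExcludedMiddle)
open import Data.Bool.Base using (Bool; true; false; if_then_else_)
open import Data.Fin.Base using (Fin; zero; suc)
open import Data.Fin.Subset using (Subset; _∈_; ∣_∣; inside; outside)
open import Data.List.Base using (List; []; _∷_; [_]; _++_; map; foldr; cartesianProductWith)
open import Data.List.Relation.Unary.Linked using (Linked)
open import Data.Nat.Base as ℕ using (ℕ; zero; suc)
open import Data.Product.Base using (Σ; ∃; ∃₂; _×_; _,_; proj₁; proj₂)
open import Data.Vec.Base as Vec using (lookup)
open import Function.Bundles using (_↔_; _⇔_; Inverse)
open import Level using (0ℓ)
open import Relation.Binary.Construct.Closure.ReflexiveTransitive using (Star)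
open import Relation.Binary.Core using (Rel)
open import Relation.Binary.PropositionalEquality.Core using (_≡_; _≢_)
open import Relation.Binary.Structures using (IsTotalOrder)
open import Relation.Nullary.Decidable using (yes; no; does)
open import Relation.Nullary.Negation using (¬_)

-- The axioms of the real numbers: a Dedekind-complete totally ordered field,
-- unique up to isomorphism.

record CompleteOrderedField : Set₁ where
  infix  4 _≤_ _<_
  infix  8 _⁻¹

  field
    commutativeRing : CommutativeRing 0ℓ 0ℓ

  open CommutativeRing commutativeRing public
    hiding (zero; _≉_)

  _≉_ : Rel Carrier 0ℓ
  x ≉ y = ¬ (x ≈ y)

  field
    _≤_          : Rel Carrier 0ℓ
    isTotalOrder : IsTotalOrder _≈_ _≤_
    +-monoˡ-≤    : ∀ {x y} z → x ≤ y → x + z ≤ y + z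
    *-nonNeg     : ∀ {x y} → 0# ≤ x → 0# ≤ y → 0# ≤ x * y
    0≉1          : 0# ≉ 1#
    -- The value 0# ⁻¹ is left unspecified.
    _⁻¹          : Carrier → Carrier
    ⁻¹-cong      : ∀ {x y} → x ≈ y → x ⁻¹ ≈ y ⁻¹
    ⁻¹-inverseʳ  : ∀ {x} → x ≉ 0# → x * x ⁻¹ ≈ 1#

  _<_ : Rel Carrier 0ℓ
  x < y = x ≤ y × x ≉ y

  UpperBound : (Carrier → Set) → Carrier → Set
  UpperBound S b = ∀ {x} → S x → x ≤ b

  field
    complete : (S : Carrier → Set) → ∃ S → ∃ (UpperBound S) →
               ∃ λ s → UpperBound S s × (∀ {b} → UpperBound S b → s ≤ b)

-- A simple graph on V is given by its adjacency relation; the relations used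
-- below are irreflexive and symmetric by construction.

Graph : Set → Set₁
Graph V = Rel V 0ℓ

_≅_ : {V W : Set} → Graph V → Graph W → Set
_≅_ {V} {W} G H =
  Σ (V ↔ W) λ f → ∀ x y → G x y ⇔ H (Inverse.to f x) (Inverse.to f y)

Colourable : {V : Set} → Graph V → ℕ → Set
Colourable {V} G k =
  Σ (V → Fin k) λ c → ∀ {x y} → G x y → c x ≢ c y

χ[_]≡_ : {V : Set} → Graph V → ℕ → Set
χ[ G ]≡ k = Colourable G k × (∀ j → Colourable G j → k ℕ.≤ j)

Connected : {V : Set} → Graph V → Set
Connected G = ∀ x y → Star G x y

-- The sample space of G(n,p): each labelled simple graph on Fin n is
-- represented exactly once, s ∷ g being g on the vertices 1, 2, … together
-- with a vertex 0 whose set of neighbours is s (shifted by one).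

infixr 5 _∷_

data LabelledGraph : ℕ → Set where
  []  : LabelledGraph 0
  _∷_ : ∀ {n} → Subset n → LabelledGraph n → LabelledGraph (suc n)

edge? : ∀ {n} → LabelledGraph n → Fin n → Fin n → Bool
edge? (s ∷ g) zero    zero    = false
edge? (s ∷ g) zero    (suc j) = lookup s j
edge? (s ∷ g) (suc i) zero    = lookup s i
edge? (s ∷ g) (suc i) (suc j) = edge? g i j

induced : ∀ {n} → LabelledGraph n → (W : Subset n) → Graph (∃ (_∈ W))
induced g W x y = edge? g (proj₁ x) (proj₁ y) ≡ true

allSubsets : ∀ n → List (Subset n)
allSubsets zero    = [ Vec.[] ]
allSubsets (suc n) =
  map (outside Vec.∷_) (allSubsets n) ++ map (inside Vec.∷_) (allSubsets n)

allGraphs : ∀ n → List (LabelledGraph n)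
allGraphs zero    = [ [] ]
allGraphs (suc n) = cartesianProductWith _∷_ (allSubsets n) (allGraphs n)

-- Excluded middle is needed to define the probability of an arbitrary event,
-- suprema as a total operation, and the maximum in the definition of u.

module Theory (lem : ExcludedMiddle 0ℓ) (ℝ : CompleteOrderedField) where

  open CompleteOrderedField ℝ public
  open RawSemiringDefs (Semiring.rawSemiring semiring) using (sum) renaming (_×_ to _·_)

  fromℕ : ℕ → Carrier
  fromℕ n = n · 1#

  Tends∞ : (ℕ → Carrier) → Set
  Tends∞ a = ∀ M → ∃ λ N → ∀ n → N ℕ.≤ n → M ≤ a n

  -- The least upper bound, or 0# if S is empty or unbounded above.
  sup : (Carrier → Set) → Carrier
  sup S with lem {∃ S × ∃ (UpperBound S)}
  ... | yes (nonempty , bounded) = proj₁ (complete S nonempty bounded)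
  ... | no  _                    = 0#

  √ : Carrier → Carrier
  √ x = sup λ y → y * y ≤ x

  -- On an interval [ a , b ] with 0# < a, the infimum of 1/t is 1/b.
  lowerSum : List Carrier → Carrier
  lowerSum (a ∷ b ∷ ts) = (b - a) * b ⁻¹ + lowerSum (b ∷ ts)
  lowerSum _            = 0#

  -- The integral of dt/t over [ a , b ], for 0# < a ≤ b, as the supremum of
  -- the lower Darboux sums over all partitions.
  ∫dt/t : Carrier → Carrier → Carrier
  ∫dt/t a b = sup λ s → ∃ λ ts → let partition = a ∷ ts ++ [ b ] in
    Linked _≤_ partition × s ≈ lowerSum partition

  -- Only meaningful for 0# < x.
  ln : Carrier → Carrier
  ln x = if does (lem {1# ≤ x}) then ∫dt/t 1# x else - ∫dt/t x 1#

  log : (base x : Carrier) → Carrier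
  log b x = ln x * ln b ⁻¹

  Point : ℕ → Set
  Point d = Fin d → Carrier

  dist : ∀ {d} → Point d → Point d → Carrier
  dist x y = √ (sum λ i → (x i - y i) * (x i - y i))

  -- A finite set of points is given by an enumeration without repetition.
  Distinct : ∀ {d m} → (Fin m → Point d) → Set
  Distinct pts = ∀ {i j} → (∀ c → pts i c ≈ pts j c) → i ≡ j

  IsDiam : ∀ {d m} → (Fin m → Point d) → Carrier → Set
  IsDiam pts D =
    (∃₂ λ i j → D ≈ dist (pts i) (pts j)) × (∀ i j → dist (pts i) (pts j) ≤ D)

  diameterGraph : ∀ {d m} → (Fin m → Point d) → Graph (Fin m)
  diameterGraph pts i j = i ≢ j × IsDiam pts (dist (pts i) (pts j))

  IsDiameterGraph : ℕ → {V : Set} → Graph V → Set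
  IsDiameterGraph d G = ∃ λ m → Σ (Fin m → Point d) λ pts →
    Distinct pts × G ≅ diameterGraph pts

  rowWeight : Carrier → ∀ {n} → Subset n → Carrier
  rowWeight p = Vec.foldr′ (λ e w → (if e then p else 1# - p) * w) 1#

  weight : Carrier → ∀ {n} → LabelledGraph n → Carrier
  weight p []      = 1#
  weight p (s ∷ g) = rowWeight p s * weight p g

  ℙ : ∀ n → Carrier → (LabelledGraph n → Set) → Carrier
  ℙ n p A =
    foldr _+_ 0# (map (λ g → if does (lem {A g}) then weight p g else 0#) (allGraphs n))

  -- The largest positive k ≤ b satisfying Q, or 0 if there is none.
  largest : (ℕ → Set) → ℕ → ℕ
  largest Q zero    = 0
  largest Q (suc b) = if does (lem {Q (suc b)}) then suc b else largest Q b

  Likely : ∀ n → Carrier → (LabelledGraph n → Set) → Set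
  Likely n p A = fromℕ 2 ⁻¹ < ℙ n p A

  -- In u and u′ the search may stop at n because ∣ W ∣ ≤ n: for larger k the
  -- event is empty.
  u : (d n : ℕ) → Carrier → ℕ
  u d n p = largest (λ k → Likely n p λ g → ∃ λ W →
    ∣ W ∣ ≡ k × IsDiameterGraph d (induced g W) × χ[ induced g W ]≡ (suc d)) n

  u′ : (d n : ℕ) → Carrier → ℕ
  u′ d n p = largest (λ k → Likely n p λ g → ∃ λ W →
    ∣ W ∣ ≡ k × IsDiameterGraph d (induced g W) × χ[ induced g W ]≡ (suc d)
      × Connected (induced g W)) n

{-# OPTIONS --safe #-}

-- A planar diameter graph has at most as many edges as vertices: two diameters that do not
-- share an endpoint cross, so every edge xy is the clockwise last edge at x or at y, and
-- every vertex has at most one clockwise last edge. Hence u₂(n,p) = k forces, with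
-- probability more than 1/2, a set of k vertices spanning at most k edges. By a union bound
-- with exponential tilts for the number of vertices and of edges, with X = np, q = 1 - p and
-- b = 1/q, that probability squared is at most (64 X² b³ / b ^ k) ^ k. Taking logarithms,
-- this is at most 1/4 as soon as k ln b > (2 + ε) ln X and 3 ln b + 8 ln 2 ≤ ε ln X. The
-- latter holds for large n, since either b ≤ 2 or ln b ≤ b = o(ln n) and n ≤ 2X.

module Submission where

open import Defs
import Algebra.Properties.AbelianGroup
import Algebra.Properties.CommutativeMonoid.Sum
import Algebra.Properties.CommutativeSemiring.Exp
import Algebra.Properties.Ring
import Algebra.Properties.Semiring.Mult
import Algebra.Properties.Semiring.Mult.TCOptimised
import Algebra.Solver.Ring
open import Algebra.Solver.Ring.AlmostCommutativeRing
  using (fromCommutativeRing; _-Raw-AlmostCommutative⟶_)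
open import Axiom.ExcludedMiddle using (ExcludedMiddle)
open import Data.Bool.Base using (true; if_then_else_)
open import Data.Empty using (⊥-elim)
open import Data.Fin.Base using (Fin; zero; suc)
open import Data.Fin.Properties using (suc-injective; 0≢1+n)
open import Data.Fin.Subset using (Subset; Side; _∈_; _∩_; ∣_∣; inside; outside)
open import Data.Fin.Subset.Properties using (drop-there; x∈p∩q⁻)
open import Data.Integer.Base as ℤ using (ℤ; +_; -[1+_])
import Data.Integer.Properties as ℤ
open import Data.List.Base using (List; []; _∷_; [_]; _++_; map; foldr; cartesianProductWith)
open import Data.List.Membership.Propositional using () renaming (_∈_ to _∈ₗ_)
open import Data.List.Membership.Propositional.Properties using (∈-++⁺ˡ; ∈-++⁺ʳ; ∈-map⁺)
open import Data.List.Relation.Unary.Any using (here; there)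
open import Data.List.Relation.Unary.Linked using (Linked; [-]; _∷_)
open import Data.Maybe.Base using (Maybe; just; nothing)
open import Data.Nat.Base as ℕ using (ℕ; zero; suc)
import Data.Nat.Properties as ℕ
open import Data.Nat.Solver using (module +-*-Solver)
open +-*-Solver using ()
  renaming (solve to ℕ-solve; con to con′; _:+_ to _:+′_; _:*_ to _:*′_; _:=_ to _:=′_)
open import Data.Product.Base using (Σ; ∃; ∃₂; _×_; _,_; proj₁; proj₂)
open import Data.Sign.Base using (Sign)
open import Data.Sum.Base using (_⊎_; inj₁; inj₂; [_,_]′) renaming (map to map⊎)
open import Data.Vec.Base using ([]; _∷_; here; there)
open import Data.Vec.Properties using ([]=⇒lookup)
open import Data.Vec.Properties.WithK using ([]=-irrelevant)
open import Function.Base using (_∘_)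
open import Function.Bundles using (Inverse; Equivalence; Injection)
open import Function.Properties.Inverse using (↔⇒↣)
open import Level using (0ℓ)
open import Relation.Binary.Bundles using (Poset)
import Relation.Binary.Reasoning.PartialOrder
import Relation.Binary.Reasoning.Setoid
open import Relation.Binary.PropositionalEquality.Core as ≡ using (_≡_)
open import Relation.Binary.Structures using (IsTotalOrder)
open import Relation.Nullary.Decidable using (Dec; yes; no; does)
open import Relation.Nullary.Negation using (¬_)

-- The bound 2 log_b X rests on a cancellation. Choosing k of n vertices costs about (n/k)^k,
-- choosing at most k edges among their k²/2 pairs costs about k^k, and the presence of these edges
-- contributes p^k. The powers of k cancel, and (np)^k is left against b^(-k²/2) for the absent
-- pairs. The tilts reproduce this without factorials: n/k per vertex times kp/q per edge is X b.
-- The bound is squared because there are k(k-1)/2 pairs; after squaring, all exponents are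
-- multiples of k. The 64 is 4·4·4, each 4 bounding a power (1 + 1/m)^m: two come from the squared
-- vertex tilt and one from the pairs. Since `√` and `ln` are given only as suprema, the geometry is
-- carried by polynomial identities in squared distances and signed areas, and the laws of `ln` are
-- read off from partitions.

module OrderedField (lem : ExcludedMiddle 0ℓ) (ℝ : CompleteOrderedField) where

  open Theory lem ℝ public
  open IsTotalOrder isTotalOrder public
    using (isPartialOrder; antisym)
    renaming (refl to ≤-refl; trans to ≤-trans; reflexive to ≤-reflexive; total to ≤-total;
              ≲-respˡ-≈ to ≤-respˡ-≈; ≲-respʳ-≈ to ≤-respʳ-≈)

  ≤-poset : Poset 0ℓ 0ℓ 0ℓ
  ≤-poset = record { isPartialOrder = isPartialOrder }

  module ≤-Reasoning = Relation.Binary.Reasoning.PartialOrder ≤-poset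
  module ≈-Reasoning = Relation.Binary.Reasoning.Setoid setoid

  open Algebra.Properties.Ring ring public
    using (-‿distribˡ-*; -‿distribʳ-*)
  open Algebra.Properties.AbelianGroup +-abelianGroup public
    using () renaming (⁻¹-∙-comm to -‿+-comm; ⁻¹-involutive to -‿involutive; ε⁻¹≈ε to -0≈0)
  open Algebra.Properties.CommutativeSemiring.Exp commutativeSemiring public
  open Algebra.Properties.Semiring.Mult semiring public
    using (×1-homo-*; ×-homo-+)

  -- Integer coefficients for the ring solver

  module Mult = Algebra.Properties.Semiring.Mult.TCOptimised semiring

  -- Integer coefficients let the solver compare and cancel numerals, although equality in `Carrier`
  -- has no decision that computes. With this variant of the multiple, one times `1#` reduces to
  -- `1#`, so that `1-homo` is `refl`.
  fromℤ : ℤ → Carrier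
  fromℤ (+ n)    = n Mult.× 1#
  fromℤ -[1+ n ] = - (suc n Mult.× 1#)

  fromℤ-⊖ : ∀ m n → fromℤ (m ℤ.⊖ n) ≈ (m Mult.× 1#) - (n Mult.× 1#)
  fromℤ-⊖ zero    zero    = sym (-‿inverseʳ 0#)
  fromℤ-⊖ zero    (suc n) = sym (+-identityˡ _)
  fromℤ-⊖ (suc m) zero    = sym (trans (+-congˡ -0≈0) (+-identityʳ _))
  fromℤ-⊖ (suc m) (suc n) = begin
    fromℤ (suc m ℤ.⊖ suc n)          ≡⟨ ≡.cong fromℤ (ℤ.[1+m]⊖[1+n]≡m⊖n m n) ⟩
    fromℤ (m ℤ.⊖ n)                  ≈⟨ fromℤ-⊖ m n ⟩
    a - b                            ≈⟨ +-congʳ (+-identityʳ a) ⟨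
    (a + 0#) - b                     ≈⟨ +-congʳ (+-congˡ (-‿inverseʳ 1#)) ⟨
    (a + (1# - 1#)) - b              ≈⟨ +-congʳ (+-assoc a 1# (- 1#)) ⟨
    ((a + 1#) - 1#) - b              ≈⟨ +-assoc (a + 1#) (- 1#) (- b) ⟩
    (a + 1#) + (- 1# - b)            ≈⟨ +-cong (+-comm a 1#) (-‿+-comm 1# b) ⟩
    (1# + a) - (1# + b)              ≈⟨ +-cong (Mult.1+× m 1#) (-‿cong (Mult.1+× n 1#)) ⟨
    (suc m Mult.× 1#) - (suc n Mult.× 1#)    ∎
    where
    open ≈-Reasoning
    a = m Mult.× 1#
    b = n Mult.× 1#

  fromℤ-neg : ∀ n → fromℤ (ℤ.- (+ n)) ≈ - (n Mult.× 1#)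
  fromℤ-neg zero    = sym -0≈0
  fromℤ-neg (suc n) = refl

  fromℤ-+ : ∀ i j → fromℤ (i ℤ.+ j) ≈ fromℤ i + fromℤ j
  fromℤ-+ (+ m)    (+ n)    = Mult.×-homo-+ 1# m n
  fromℤ-+ (+ m)    -[1+ n ] = fromℤ-⊖ m (suc n)
  fromℤ-+ -[1+ m ] (+ n)    = trans (fromℤ-⊖ n (suc m)) (+-comm _ _)
  fromℤ-+ -[1+ m ] -[1+ n ] = trans
    (-‿cong (trans (reflexive (≡.cong (λ k → suc k Mult.× 1#) (≡.sym (ℕ.+-suc m n))))
                   (Mult.×-homo-+ 1# (suc m) (suc n))))
    (sym (-‿+-comm _ _))

  fromℤ-◃- : ∀ n → fromℤ (Sign.- ℤ.◃ n) ≈ - (n Mult.× 1#)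
  fromℤ-◃- n = trans (reflexive (≡.cong fromℤ (ℤ.-◃n≡-n n))) (fromℤ-neg n)

  fromℤ-* : ∀ i j → fromℤ (i ℤ.* j) ≈ fromℤ i * fromℤ j
  fromℤ-* (+ m)    (+ n)    = trans
    (reflexive (≡.cong fromℤ (ℤ.+◃n≡+n (m ℕ.* n)))) (Mult.×1-homo-* m n)
  fromℤ-* (+ m)    -[1+ n ] = trans (fromℤ-◃- (m ℕ.* suc n))
    (trans (-‿cong (Mult.×1-homo-* m (suc n))) (-‿distribʳ-* _ _))
  fromℤ-* -[1+ m ] (+ n)    = trans (fromℤ-◃- (suc m ℕ.* n))
    (trans (-‿cong (Mult.×1-homo-* (suc m) n)) (-‿distribˡ-* _ _))
  fromℤ-* -[1+ m ] -[1+ n ] = begin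
    fromℤ (-[1+ m ] ℤ.* -[1+ n ])   ≈⟨ Mult.×1-homo-* (suc m) (suc n) ⟩
    a * b                           ≈⟨ -‿involutive _ ⟨
    - (- (a * b))                   ≈⟨ -‿cong (-‿distribˡ-* a b) ⟩
    - (- a * b)                     ≈⟨ -‿distribʳ-* (- a) b ⟩
    - a * - b                       ∎
    where
    open ≈-Reasoning
    a = suc m Mult.× 1#
    b = suc n Mult.× 1#

  fromℤ-‿- : ∀ i → fromℤ (ℤ.- i) ≈ - fromℤ i
  fromℤ-‿- (+ n)    = fromℤ-neg n
  fromℤ-‿- -[1+ n ] = sym (-‿involutive _)

  fromℤ-morphism : ℤ.+-*-rawRing -Raw-AlmostCommutative⟶ fromCommutativeRing commutativeRing
  fromℤ-morphism = record
    { ⟦_⟧    = fromℤ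
    ; +-homo = fromℤ-+
    ; *-homo = fromℤ-*
    ; -‿homo = fromℤ-‿-
    ; 0-homo = refl
    ; 1-homo = refl
    }

  fromℤ-≟ : ∀ i j → Maybe (fromℤ i ≈ fromℤ j)
  fromℤ-≟ i j with i ℤ.≟ j
  ... | yes i≡j = just (reflexive (≡.cong fromℤ i≡j))
  ... | no  _   = nothing

  open Algebra.Solver.Ring ℤ.+-*-rawRing (fromCommutativeRing commutativeRing)
    fromℤ-morphism fromℤ-≟ public
    using (Polynomial; solve; _:=_; _:+_; _:-_; _:*_; :-_; con; _:^_)

  -- Unlike con (+ 2), which denotes 1# + 1#, :2 denotes fromℕ 2 definitionally.
  :0 :1 :2 :4 : ∀ {n} → Polynomial n
  :0 = con (+ 0)
  :1 = con (+ 1)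
  :2 = :1 :+ (:1 :+ :0)
  :4 = :1 :+ (:1 :+ :2)


  -- Arithmetic of ordered fields

  x≤y⇒0≤y-x : ∀ {x y} → x ≤ y → 0# ≤ y - x
  x≤y⇒0≤y-x {x} {y} x≤y = ≤-respˡ-≈ (-‿inverseʳ x) (+-monoˡ-≤ (- x) x≤y)

  0≤y-x⇒x≤y : ∀ {x y} → 0# ≤ y - x → x ≤ y
  0≤y-x⇒x≤y {x} {y} 0≤y-x = ≤-respˡ-≈ (+-identityˡ x)
    (≤-respʳ-≈ (solve 2 (λ x y → y :- x :+ x := y) refl x y) (+-monoˡ-≤ x 0≤y-x))

  -- A certificate for inequalities: the solver checks that the difference equals `c`, and only the
  -- sign of `c` remains.
  ≤-witness : ∀ {x y c} → 0# ≤ c → y - x ≈ c → x ≤ y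
  ≤-witness 0≤c y-x≈c = 0≤y-x⇒x≤y (≤-respʳ-≈ (sym y-x≈c) 0≤c)

  +-monoʳ-≤ : ∀ x {y z} → y ≤ z → x + y ≤ x + z
  +-monoʳ-≤ x y≤z = ≤-respˡ-≈ (+-comm _ x) (≤-respʳ-≈ (+-comm _ x) (+-monoˡ-≤ x y≤z))

  +-mono-≤ : ∀ {x y z w} → x ≤ y → z ≤ w → x + z ≤ y + w
  +-mono-≤ x≤y z≤w = ≤-trans (+-monoˡ-≤ _ x≤y) (+-monoʳ-≤ _ z≤w)

  +-nonNeg : ∀ {x y} → 0# ≤ x → 0# ≤ y → 0# ≤ x + y
  +-nonNeg 0≤x 0≤y = ≤-respˡ-≈ (+-identityˡ 0#) (+-mono-≤ 0≤x 0≤y)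

  x≤x+y : ∀ {x y} → 0# ≤ y → x ≤ x + y
  x≤x+y {x} 0≤y = ≤-respˡ-≈ (+-identityʳ x) (+-monoʳ-≤ x 0≤y)

  x≤y+x : ∀ {x y} → 0# ≤ y → x ≤ y + x
  x≤y+x {x} 0≤y = ≤-respˡ-≈ (+-identityˡ x) (+-monoˡ-≤ x 0≤y)

  x-y≤x : ∀ {x y} → 0# ≤ y → x - y ≤ x
  x-y≤x {x} {y} 0≤y = ≤-witness 0≤y (solve 2 (λ x y → x :- (x :- y) := y) refl x y)

  *-monoʳ-≤ : ∀ {x y z} → 0# ≤ x → y ≤ z → x * y ≤ x * z
  *-monoʳ-≤ {x} {y} {z} 0≤x y≤z = ≤-witness (*-nonNeg 0≤x (x≤y⇒0≤y-x y≤z))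
    (solve 3 (λ x y z → x :* z :- x :* y := x :* (z :- y)) refl x y z)

  *-monoˡ-≤ : ∀ {x y z} → 0# ≤ x → y ≤ z → y * x ≤ z * x
  *-monoˡ-≤ 0≤x y≤z = ≤-respˡ-≈ (*-comm _ _) (≤-respʳ-≈ (*-comm _ _) (*-monoʳ-≤ 0≤x y≤z))

  *-mono-≤ : ∀ {x y z w} → 0# ≤ z → 0# ≤ y → x ≤ y → z ≤ w → x * z ≤ y * w
  *-mono-≤ 0≤z 0≤y x≤y z≤w = ≤-trans (*-monoˡ-≤ 0≤z x≤y) (*-monoʳ-≤ 0≤y z≤w)

  0≤x² : ∀ x → 0# ≤ x * x
  0≤x² x with ≤-total 0# x
  ... | inj₁ 0≤x = *-nonNeg 0≤x 0≤x
  ... | inj₂ x≤0 = ≤-respʳ-≈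
    (solve 1 (λ x → (:0 :- x) :* (:0 :- x) := x :* x) refl x)
    (*-nonNeg (x≤y⇒0≤y-x x≤0) (x≤y⇒0≤y-x x≤0))

  0≤1 : 0# ≤ 1#
  0≤1 = ≤-respʳ-≈ (*-identityˡ 1#) (0≤x² 1#)

  0<1 : 0# < 1#
  0<1 = 0≤1 , 0≉1

  ≰⇒> : ∀ {x y} → ¬ (x ≤ y) → y < x
  ≰⇒> {x} {y} x≰y with ≤-total x y
  ... | inj₁ x≤y = ⊥-elim (x≰y x≤y)
  ... | inj₂ y≤x = y≤x , λ y≈x → x≰y (≤-reflexive (sym y≈x))

  <⇒≱ : ∀ {x y} → x < y → ¬ (y ≤ x)
  <⇒≱ (x≤y , x≉y) y≤x = x≉y (antisym x≤y y≤x)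

  ≤-or-> : ∀ x y → x ≤ y ⊎ y < x
  ≤-or-> x y with lem {x ≤ y}
  ... | yes x≤y = inj₁ x≤y
  ... | no  x≰y = inj₂ (≰⇒> x≰y)

  ≮⇒≥ : ∀ {x y} → ¬ (x < y) → y ≤ x
  ≮⇒≥ {x} {y} x≮y with ≤-or-> y x
  ... | inj₁ y≤x = y≤x
  ... | inj₂ x<y = ⊥-elim (x≮y x<y)

  <-≤-trans : ∀ {x y z} → x < y → y ≤ z → x < z
  <-≤-trans x<y y≤z = ≰⇒> λ z≤x → <⇒≱ x<y (≤-trans y≤z z≤x)

  ≤-<-trans : ∀ {x y z} → x ≤ y → y < z → x < z
  ≤-<-trans x≤y y<z = ≰⇒> λ z≤x → <⇒≱ y<z (≤-trans z≤x x≤y)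

  0<x⇒x≉0 : ∀ {x} → 0# < x → x ≉ 0#
  0<x⇒x≉0 (_ , 0≉x) x≈0 = 0≉x (sym x≈0)

  1≤x⇒0<x : ∀ {x} → 1# ≤ x → 0# < x
  1≤x⇒0<x = <-≤-trans 0<1

  +-pos-nonNeg : ∀ {x y} → 0# < x → 0# ≤ y → 0# < x + y
  +-pos-nonNeg 0<x 0≤y = <-≤-trans 0<x (x≤x+y 0≤y)

  x<y⇒0<y-x : ∀ {x y} → x < y → 0# < y - x
  x<y⇒0<y-x {x} {y} x<y@(x≤y , _) = ≰⇒> λ y-x≤0 →
    <⇒≱ x<y (≤-witness (x≤y⇒0≤y-x y-x≤0) (solve 2 (λ x y → x :- y := :0 :- (y :- x)) refl x y))

  0<y-x⇒x<y : ∀ {x y} → 0# < y - x → x < y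
  0<y-x⇒x<y {x} {y} 0<y-x = ≰⇒> λ y≤x →
    <⇒≱ 0<y-x (≤-witness (x≤y⇒0≤y-x y≤x) (solve 2 (λ x y → :0 :- (y :- x) := x :- y) refl x y))

  ⁻¹-inverseˡ : ∀ {x} → x ≉ 0# → x ⁻¹ * x ≈ 1#
  ⁻¹-inverseˡ x≉0 = trans (*-comm _ _) (⁻¹-inverseʳ x≉0)

  *-pos : ∀ {x y} → 0# < x → 0# < y → 0# < x * y
  *-pos {x} {y} 0<x@(0≤x , _) (0≤y , 0≉y) = *-nonNeg 0≤x 0≤y , λ 0≈xy → 0≉y (begin
    0#               ≈⟨ zeroʳ (x ⁻¹) ⟨
    x ⁻¹ * 0#        ≈⟨ *-congˡ 0≈xy ⟩
    x ⁻¹ * (x * y)   ≈⟨ *-assoc _ _ _ ⟨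
    x ⁻¹ * x * y     ≈⟨ *-congʳ (⁻¹-inverseˡ (0<x⇒x≉0 0<x)) ⟩
    1# * y           ≈⟨ *-identityˡ y ⟩
    y                ∎)
    where open ≈-Reasoning

  *-cancelˡ-≤ : ∀ {x y z} → 0# < x → x * y ≤ x * z → y ≤ z
  *-cancelˡ-≤ {x} {y} {z} 0<x xy≤xz = ≮⇒≥ λ z<y → <⇒≱
    (0<y-x⇒x<y (<-≤-trans (*-pos 0<x (x<y⇒0<y-x z<y)) (≤-reflexive
      (solve 3 (λ x y z → x :* (y :- z) := x :* y :- x :* z) refl x y z))))
    xy≤xz

  *-cancelʳ-≤ : ∀ {x y z} → 0# < x → y * x ≤ z * x → y ≤ z
  *-cancelʳ-≤ 0<x yx≤zx = *-cancelˡ-≤ 0<x (≤-respˡ-≈ (*-comm _ _) (≤-respʳ-≈ (*-comm _ _) yx≤zx))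

  ⁻¹-pos : ∀ {x} → 0# < x → 0# < x ⁻¹
  ⁻¹-pos {x} 0<x@(0≤x , _) = ≰⇒> λ x⁻¹≤0 → <⇒≱ 0<1
    (≤-respˡ-≈ (⁻¹-inverseʳ (0<x⇒x≉0 0<x)) (≤-respʳ-≈ (zeroʳ x) (*-monoʳ-≤ 0≤x x⁻¹≤0)))

  ⁻¹-nonNeg : ∀ {x} → 0# < x → 0# ≤ x ⁻¹
  ⁻¹-nonNeg 0<x = proj₁ (⁻¹-pos 0<x)

  ⁻¹-antimono-≤ : ∀ {x y} → 0# < x → x ≤ y → y ⁻¹ ≤ x ⁻¹
  ⁻¹-antimono-≤ {x} {y} 0<x x≤y = *-cancelˡ-≤ 0<x (*-cancelʳ-≤ 0<y (begin
    x * y ⁻¹ * y      ≈⟨ *-assoc _ _ _ ⟩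
    x * (y ⁻¹ * y)    ≈⟨ *-congˡ (⁻¹-inverseˡ (0<x⇒x≉0 0<y)) ⟩
    x * 1#            ≈⟨ *-identityʳ x ⟩
    x                 ≤⟨ x≤y ⟩
    y                 ≈⟨ *-identityˡ y ⟨
    1# * y            ≈⟨ *-congʳ (⁻¹-inverseʳ (0<x⇒x≉0 0<x)) ⟨
    x * x ⁻¹ * y      ∎))
    where
    open ≤-Reasoning
    0<y = <-≤-trans 0<x x≤y

  ⁻¹-unique : ∀ {x y} → x * y ≈ 1# → y ≈ x ⁻¹
  ⁻¹-unique {x} {y} xy≈1 = begin
    y                ≈⟨ *-identityˡ y ⟨
    1# * y           ≈⟨ *-congʳ (⁻¹-inverseˡ x≉0) ⟨
    x ⁻¹ * x * y     ≈⟨ *-assoc _ _ _ ⟩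
    x ⁻¹ * (x * y)   ≈⟨ *-congˡ xy≈1 ⟩
    x ⁻¹ * 1#        ≈⟨ *-identityʳ _ ⟩
    x ⁻¹             ∎
    where
    open ≈-Reasoning
    x≉0 : x ≉ 0#
    x≉0 x≈0 = 0≉1 (trans (sym (zeroˡ y)) (trans (*-congʳ (sym x≈0)) xy≈1))

  ⁻¹-distrib-* : ∀ {x y} → x ≉ 0# → y ≉ 0# → (x * y) ⁻¹ ≈ x ⁻¹ * y ⁻¹
  ⁻¹-distrib-* {x} {y} x≉0 y≉0 = sym (⁻¹-unique (begin
    x * y * (x ⁻¹ * y ⁻¹)       ≈⟨ solve 4 (λ a b c d → a :* b :* (c :* d) := a :* c :* (b :* d)) refl _ _ _ _ ⟩
    (x * x ⁻¹) * (y * y ⁻¹)     ≈⟨ *-cong (⁻¹-inverseʳ x≉0) (⁻¹-inverseʳ y≉0) ⟩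
    1# * 1#                     ≈⟨ *-identityʳ 1# ⟩
    1#                          ∎))
    where open ≈-Reasoning

  -- If `y < x`, then `0 ≤ y` makes both factors of `(x - y) * (x + y)` positive. The sign of `x` is
  -- left free, which suits the set whose supremum is `√`.
  square-cancel-≤ : ∀ {x y} → 0# ≤ y → x * x ≤ y * y → x ≤ y
  square-cancel-≤ {x} {y} 0≤y x²≤y² = ≮⇒≥ λ y<x@(y≤x , _) → <⇒≱
    (0<y-x⇒x<y (<-≤-trans (*-pos (x<y⇒0<y-x y<x) (+-pos-nonNeg (≤-<-trans 0≤y y<x) 0≤y))
      (≤-reflexive (solve 2 (λ x y → (x :- y) :* (x :+ y) := x :* x :- y :* y) refl x y))))
    x²≤y²

  ^-nonNeg : ∀ {x} → 0# ≤ x → ∀ n → 0# ≤ x ^ n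
  ^-nonNeg 0≤x zero    = 0≤1
  ^-nonNeg 0≤x (suc n) = *-nonNeg 0≤x (^-nonNeg 0≤x n)

  ^-pos : ∀ {x} → 0# < x → ∀ n → 0# < x ^ n
  ^-pos 0<x zero    = 0<1
  ^-pos 0<x (suc n) = *-pos 0<x (^-pos 0<x n)

  ^-mono-≤ : ∀ {x y} → 0# ≤ x → x ≤ y → ∀ n → x ^ n ≤ y ^ n
  ^-mono-≤ 0≤x x≤y zero    = ≤-refl
  ^-mono-≤ 0≤x x≤y (suc n) =
    *-mono-≤ (^-nonNeg 0≤x n) (≤-trans 0≤x x≤y) x≤y (^-mono-≤ 0≤x x≤y n)

  1^n≈1 : ∀ n → 1# ^ n ≈ 1#
  1^n≈1 zero    = refl
  1^n≈1 (suc n) = trans (*-identityˡ _) (1^n≈1 n)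

  1≤x^n : ∀ {x} → 1# ≤ x → ∀ n → 1# ≤ x ^ n
  1≤x^n 1≤x n = ≤-respˡ-≈ (1^n≈1 n) (^-mono-≤ 0≤1 1≤x n)

  x^n≤1 : ∀ {x} → 0# ≤ x → x ≤ 1# → ∀ n → x ^ n ≤ 1#
  x^n≤1 0≤x x≤1 n = ≤-respʳ-≈ (1^n≈1 n) (^-mono-≤ 0≤x x≤1 n)

  ^-antimonoʳ-≤ : ∀ {x m n} → 0# ≤ x → x ≤ 1# → m ℕ.≤ n → x ^ n ≤ x ^ m
  ^-antimonoʳ-≤ {n = n} 0≤x x≤1 ℕ.z≤n       = x^n≤1 0≤x x≤1 n
  ^-antimonoʳ-≤ 0≤x x≤1 (ℕ.s≤s m≤n) = *-monoʳ-≤ 0≤x (^-antimonoʳ-≤ 0≤x x≤1 m≤n)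

  fromℕ-nonNeg : ∀ n → 0# ≤ fromℕ n
  fromℕ-nonNeg zero    = ≤-refl
  fromℕ-nonNeg (suc n) = +-nonNeg 0≤1 (fromℕ-nonNeg n)

  1≤fromℕ[1+n] : ∀ n → 1# ≤ fromℕ (suc n)
  1≤fromℕ[1+n] n = x≤x+y (fromℕ-nonNeg n)

  bernoulli : ∀ {x} → 0# ≤ 1# + x → ∀ n → 1# + fromℕ n * x ≤ (1# + x) ^ n
  bernoulli {x} 0≤1+x zero    = ≤-reflexive (trans (+-congˡ (zeroˡ x)) (+-identityʳ 1#))
  bernoulli {x} 0≤1+x (suc n) = begin
    1# + (1# + fromℕ n) * x            ≤⟨ ≤-witness (*-nonNeg (fromℕ-nonNeg n) (0≤x² x))
      (solve 2 (λ k x → (:1 :+ x) :* (:1 :+ k :* x) :- (:1 :+ (:1 :+ k) :* x) := k :* (x :* x)) refl _ _) ⟩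
    (1# + x) * (1# + fromℕ n * x)      ≤⟨ *-monoʳ-≤ 0≤1+x (bernoulli 0≤1+x n) ⟩
    (1# + x) * (1# + x) ^ n            ∎
    where open ≤-Reasoning

  -- If the naturals were bounded, their supremum `s` would satisfy `n + 1 ≤ s` for every `n`, and
  -- `s - 1` would be a smaller upper bound.
  archimedean : ∀ x → ∃ λ n → x ≤ fromℕ n
  archimedean x with lem {∃ λ n → x ≤ fromℕ n}
  ... | yes found = found
  ... | no  none  = ⊥-elim (<⇒≱ 0<1 (≤-witness (x≤y⇒0≤y-x (least λ {y} → bound {y}))
    (solve 1 (λ s → :0 :- :1 := s :- :1 :- s) refl s)))
    where
    S : Carrier → Set
    S y = ∃ λ n → y ≈ fromℕ n
    lub = complete S (0# , 0 , refl)
      (x , λ { (n , y≈n) → ≤-respˡ-≈ (sym y≈n) (proj₁ (≰⇒> λ x≤n → none (n , x≤n))) })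
    s = proj₁ lub
    least = proj₂ (proj₂ lub)
    bound : UpperBound S (s - 1#)
    bound {y} (n , y≈n) = ≤-witness (x≤y⇒0≤y-x (proj₁ (proj₂ lub) {1# + y} (suc n , +-congˡ y≈n)))
      (solve 2 (λ s y → s :- :1 :- y := s :- (:1 :+ y)) refl s y)

-- Suprema and square roots

module Supremum (lem : ExcludedMiddle 0ℓ) (ℝ : CompleteOrderedField) where

  open OrderedField lem ℝ public

  sup-upper : ∀ S → ∃ (UpperBound S) → UpperBound S (sup S)
  sup-upper S bounded {x} x∈S with lem {∃ S × ∃ (UpperBound S)}
  ... | yes (nonempty , bounded′) = proj₁ (proj₂ (complete S nonempty bounded′)) x∈S
  ... | no  ¬both                 = ⊥-elim (¬both ((x , x∈S) , bounded))

  sup-least : ∀ S {b} → ∃ S → UpperBound S b → sup S ≤ b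
  sup-least S {b} nonempty ub with lem {∃ S × ∃ (UpperBound S)}
  ... | yes (nonempty′ , bounded) = proj₂ (proj₂ (complete S nonempty′ bounded)) (λ {x} → ub {x})
  ... | no  ¬both                 = ⊥-elim (¬both (nonempty , b , λ {x} → ub {x}))

  √-bounded : ∀ {x} → 0# ≤ x → UpperBound (λ y → y * y ≤ x) (x + 1#)
  √-bounded {x} 0≤x {y} y²≤x = square-cancel-≤ (+-nonNeg 0≤x 0≤1)
    (≤-trans y²≤x (≤-witness (+-nonNeg (+-nonNeg (0≤x² x) 0≤x) 0≤1)
      (solve 1 (λ x → (x :+ :1) :* (x :+ :1) :- x := x :* x :+ x :+ :1) refl x)))

  √-upper : ∀ {x y} → 0# ≤ x → y * y ≤ x → y ≤ √ x
  √-upper {x} 0≤x = sup-upper (λ y → y * y ≤ x) (x + 1# , λ {y} → √-bounded 0≤x {y})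

  √-nonNeg : ∀ {x} → 0# ≤ x → 0# ≤ √ x
  √-nonNeg 0≤x = √-upper 0≤x (≤-respˡ-≈ (sym (zeroˡ 0#)) 0≤x)

  -- If s = √ x had s * s > x, then s - δ with 2 δ s = s * s - x would be a smaller upper bound.
  √x*√x≤x : ∀ {x} → 0# ≤ x → √ x * √ x ≤ x
  √x*√x≤x {x} 0≤x = ≮⇒≥ λ x<s² →
    let
      s    = √ x
      e    = s * s - x
      0<e  = x<y⇒0<y-x x<s²
      0≤s  = √-nonNeg 0≤x
      0<s  : 0# < s
      0<s  = ≰⇒> λ s≤0 → <⇒≱ (≤-<-trans 0≤x x<s²)
               (≤-respʳ-≈ (zeroʳ s) (*-monoʳ-≤ 0≤s s≤0))
      0<2s : 0# < s + s
      0<2s = +-pos-nonNeg 0<s 0≤s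
      δ    = e * (s + s) ⁻¹
      0<δ  = *-pos 0<e (⁻¹-pos 0<2s)
      2sδ≈e : (s + s) * δ ≈ e
      2sδ≈e = begin-equality
        (s + s) * (e * (s + s) ⁻¹)   ≈⟨ solve 3 (λ a b c → a :* (b :* c) := b :* (a :* c)) refl _ _ _ ⟩
        e * ((s + s) * (s + s) ⁻¹)   ≈⟨ *-congˡ (⁻¹-inverseʳ (0<x⇒x≉0 0<2s)) ⟩
        e * 1#                       ≈⟨ *-identityʳ e ⟩
        e                            ∎
      x≤[s-δ]² : x ≤ (s - δ) * (s - δ)
      x≤[s-δ]² = ≤-witness (0≤x² δ) (begin-equality
        (s - δ) * (s - δ) - x                 ≈⟨ solve 3 (λ s d x →
          (s :- d) :* (s :- d) :- x := (s :* s :- x) :- (s :+ s) :* d :+ d :* d) refl _ _ _ ⟩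
        (s * s - x) - (s + s) * δ + δ * δ     ≈⟨ +-congʳ (+-congˡ (-‿cong 2sδ≈e)) ⟩
        e - e + δ * δ                         ≈⟨ solve 2 (λ e d → e :- e :+ d := d) refl _ _ ⟩
        δ * δ                                 ∎)
      0≤s-δ : 0# ≤ s - δ
      0≤s-δ = *-cancelˡ-≤ 0<2s (≤-witness (+-nonNeg (0≤x² s) 0≤x) (begin-equality
        (s + s) * (s - δ) - (s + s) * 0#         ≈⟨ solve 2 (λ s d →
          (s :+ s) :* (s :- d) :- (s :+ s) :* :0 := (s :+ s) :* s :- (s :+ s) :* d) refl _ _ ⟩
        (s + s) * s - (s + s) * δ                ≈⟨ +-congˡ (-‿cong 2sδ≈e) ⟩
        (s + s) * s - (s * s - x)                ≈⟨ solve 2 (λ s x →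
          (s :+ s) :* s :- (s :* s :- x) := s :* s :+ x) refl _ _ ⟩
        s * s + x                                ∎))
    in <⇒≱ 0<δ (≤-witness
         (x≤y⇒0≤y-x (sup-least (λ y → y * y ≤ x) (0# , ≤-respˡ-≈ (sym (zeroˡ 0#)) 0≤x)
           λ {y} y²≤x → square-cancel-≤ 0≤s-δ (≤-trans y²≤x x≤[s-δ]²)))
         (solve 2 (λ s d → :0 :- d := s :- d :- s) refl s δ))
    where open ≤-Reasoning

  -- If `y < x`, then `s = √ y` has `s * s ≤ y < x`, so it can be raised to some `s + δ` whose
  -- square is still at most `x`; but `s + δ ≤ √ x ≤ s` is absurd. This passes from the distances in
  -- `IsDiam` to their squares, which are polynomials.
  √-cancel-≤ : ∀ {x y} → 0# ≤ x → 0# ≤ y → √ x ≤ √ y → x ≤ y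
  √-cancel-≤ {x} {y} 0≤x 0≤y √x≤√y = ≮⇒≥ λ y<x →
    let
      s     = √ y
      0≤s   = √-nonNeg 0≤y
      m     = 1# + (s + s)
      0<m   : 0# < m
      0<m   = +-pos-nonNeg 0<1 (+-nonNeg 0≤s 0≤s)
      e     = x - s * s
      0<e   : 0# < e
      0<e   = x<y⇒0<y-x (≤-<-trans (√x*√x≤x 0≤y) y<x)
      -- As `m = 1 + 2 s` and `δ ≤ 1`, moving from `s` to `s + δ` raises the square by
      -- `2 s δ + δ² ≤ m δ ≤ e`.
      δ , 0<δ , δ≤1 , mδ≤e = small e m 0<e 0<m
      0≤δ   = proj₁ 0<δ
      [s+δ]²≤x : (s + δ) * (s + δ) ≤ x
      [s+δ]²≤x = ≤-witness (+-nonNeg (x≤y⇒0≤y-x mδ≤e) (*-nonNeg 0≤δ (x≤y⇒0≤y-x δ≤1)))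
        (solve 3 (λ x s d → x :- (s :+ d) :* (s :+ d)
          := ((x :- s :* s) :- (:1 :+ (s :+ s)) :* d) :+ d :* (:1 :- d)) refl x s δ)
    in <⇒≱ 0<δ (≤-witness (x≤y⇒0≤y-x (≤-trans (√-upper 0≤x [s+δ]²≤x) √x≤√y))
         (solve 2 (λ s d → :0 :- d := s :- (s :+ d)) refl s δ))
    where
    small : ∀ e m → 0# < e → 0# < m → ∃ λ δ → 0# < δ × δ ≤ 1# × m * δ ≤ e
    small e m 0<e 0<m with ≤-total m e
    ... | inj₁ m≤e = 1# , 0<1 , ≤-refl , ≤-respˡ-≈ (sym (*-identityʳ m)) m≤e
    ... | inj₂ e≤m = m ⁻¹ * e , *-pos (⁻¹-pos 0<m) 0<e
      , ≤-respʳ-≈ (⁻¹-inverseˡ (0<x⇒x≉0 0<m)) (*-monoʳ-≤ (⁻¹-nonNeg 0<m) e≤m)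
      , ≤-reflexive (trans (sym (*-assoc _ _ _))
          (trans (*-congʳ (⁻¹-inverseʳ (0<x⇒x≉0 0<m))) (*-identityˡ e)))

-- The logarithm as a supremum of lower sums

module Logarithm (lem : ExcludedMiddle 0ℓ) (ℝ : CompleteOrderedField) where

  open Supremum lem ℝ public

  -- The values of `lowerSum` as an inductive family: cells replace the list, and values are taken
  -- up to `≈`. Concatenating, dilating and cutting a partition then become inductions on its cells.
  data LowerSum (a b : Carrier) : Carrier → Set where
    single : ∀ {s} → a ≤ b → s ≈ (b - a) * b ⁻¹ → LowerSum a b s
    cons   : ∀ {c s t} → a ≤ c → LowerSum c b s → t ≈ (c - a) * c ⁻¹ + s → LowerSum a b t

  LowerSum-resp : ∀ {a b s t} → s ≈ t → LowerSum a b s → LowerSum a b t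
  LowerSum-resp s≈t (single a≤b s≈)   = single a≤b (trans (sym s≈t) s≈)
  LowerSum-resp s≈t (cons a≤c S s≈) = cons a≤c S (trans (sym s≈t) s≈)

  LowerSum-≤ : ∀ {a b s} → LowerSum a b s → a ≤ b
  LowerSum-≤ (single a≤b _) = a≤b
  LowerSum-≤ (cons a≤c S _) = ≤-trans a≤c (LowerSum-≤ S)

  lowerSum⇒LowerSum : ∀ {a b} ts → Linked _≤_ (a ∷ ts ++ [ b ]) →
    LowerSum a b (lowerSum (a ∷ ts ++ [ b ]))
  lowerSum⇒LowerSum []       (a≤b ∷ _) = single a≤b (+-identityʳ _)
  lowerSum⇒LowerSum (c ∷ ts) (a≤c ∷ S) = cons a≤c (lowerSum⇒LowerSum ts S) refl

  LowerSum⇒lowerSum : ∀ {a b s} → LowerSum a b s →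
    ∃ λ ts → Linked _≤_ (a ∷ ts ++ [ b ]) × s ≈ lowerSum (a ∷ ts ++ [ b ])
  LowerSum⇒lowerSum (single a≤b s≈) = [] , (a≤b ∷ [-]) , trans s≈ (sym (+-identityʳ _))
  LowerSum⇒lowerSum (cons {c} a≤c S t≈) with LowerSum⇒lowerSum S
  ... | ts , linked , s≈ = c ∷ ts , a≤c ∷ linked , trans t≈ (+-congˡ s≈)

  -- On the whole interval 1/t is at most 1/a, so one rectangle dominates every lower sum. This
  -- bounds the set that defines `ln`, and gives `ln x ≤ x - 1`.
  LowerSum-upper : ∀ {a b s} → 0# < a → LowerSum a b s → s ≤ (b - a) * a ⁻¹
  LowerSum-upper {a} {b} {s} 0<a (single a≤b s≈) = begin
    s                 ≈⟨ s≈ ⟩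
    (b - a) * b ⁻¹    ≤⟨ *-monoʳ-≤ (x≤y⇒0≤y-x a≤b) (⁻¹-antimono-≤ 0<a a≤b) ⟩
    (b - a) * a ⁻¹    ∎
    where open ≤-Reasoning
  LowerSum-upper {a} {b} {t} 0<a (cons {c} {s} a≤c S t≈) = begin
    t                                    ≈⟨ t≈ ⟩
    (c - a) * c ⁻¹ + s                   ≤⟨ +-monoʳ-≤ _ (LowerSum-upper 0<c S) ⟩
    (c - a) * c ⁻¹ + (b - c) * c ⁻¹      ≈⟨ solve 4 (λ a b c d →
      (c :- a) :* d :+ (b :- c) :* d := (b :- a) :* d) refl _ _ _ _ ⟩
    (b - a) * c ⁻¹                       ≤⟨ *-monoʳ-≤ (x≤y⇒0≤y-x (≤-trans a≤c (LowerSum-≤ S)))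
                                              (⁻¹-antimono-≤ 0<a a≤c) ⟩
    (b - a) * a ⁻¹                       ∎
    where
    open ≤-Reasoning
    0<c = <-≤-trans 0<a a≤c

  LowerSum-++ : ∀ {a b c s t} → LowerSum a b s → LowerSum b c t → LowerSum a c (s + t)
  LowerSum-++ (single a≤b s≈) T   = cons a≤b T (+-congʳ s≈)
  LowerSum-++ (cons a≤c S s≈) T = cons a≤c (LowerSum-++ S T) (trans (+-congʳ s≈) (+-assoc _ _ _))

  scale-term : ∀ {k a b} → 0# < k → 0# < b → (k * b - k * a) * (k * b) ⁻¹ ≈ (b - a) * b ⁻¹
  scale-term {k} {a} {b} 0<k 0<b = begin
    (k * b - k * a) * (k * b) ⁻¹        ≈⟨ *-congˡ (⁻¹-distrib-* (0<x⇒x≉0 0<k) (0<x⇒x≉0 0<b)) ⟩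
    (k * b - k * a) * (k ⁻¹ * b ⁻¹)     ≈⟨ solve 5 (λ k a b k′ b′ →
      (k :* b :- k :* a) :* (k′ :* b′) := (k :* k′) :* ((b :- a) :* b′)) refl _ _ _ _ _ ⟩
    (k * k ⁻¹) * ((b - a) * b ⁻¹)       ≈⟨ *-congʳ (⁻¹-inverseʳ (0<x⇒x≉0 0<k)) ⟩
    1# * ((b - a) * b ⁻¹)               ≈⟨ *-identityˡ _ ⟩
    (b - a) * b ⁻¹                      ∎
    where open ≈-Reasoning

  -- The form dt/t is invariant under dilation, which is the source of the functional equation of
  -- `ln`. The end points are given up to `≈`, because for instance `x ⁻¹ * x` is only equivalent to
  -- `1#`.
  LowerSum-scale : ∀ {k a b a′ b′ s} → 0# < k → 0# < a → a′ ≈ k * a → b′ ≈ k * b →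
    LowerSum a b s → LowerSum a′ b′ s
  LowerSum-scale 0<k@(0≤k , _) 0<a a′≈ b′≈ (single a≤b s≈) = single
    (≤-respˡ-≈ (sym a′≈) (≤-respʳ-≈ (sym b′≈) (*-monoʳ-≤ 0≤k a≤b)))
    (trans s≈ (trans (sym (scale-term 0<k (<-≤-trans 0<a a≤b)))
      (*-cong (+-cong (sym b′≈) (-‿cong (sym a′≈))) (⁻¹-cong (sym b′≈)))))
  LowerSum-scale {k} 0<k@(0≤k , _) 0<a a′≈ b′≈ (cons {c} a≤c S t≈) =
    cons {c = k * c}
      (≤-respˡ-≈ (sym a′≈) (*-monoʳ-≤ 0≤k a≤c))
      (LowerSum-scale 0<k 0<c refl b′≈ S)
      (trans t≈ (+-congʳ (trans (sym (scale-term 0<k 0<c)) (*-congʳ (+-congˡ (-‿cong (sym a′≈)))))))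
    where 0<c = <-≤-trans 0<a a≤c

  split-term : ∀ {a x b} → 0# < x → a ≤ x → x ≤ b →
    (b - a) * b ⁻¹ ≤ (x - a) * x ⁻¹ + (b - x) * b ⁻¹
  split-term {a} {x} {b} 0<x a≤x x≤b = begin
    (b - a) * b ⁻¹                       ≈⟨ solve 4 (λ a x b d →
      (b :- a) :* d := (x :- a) :* d :+ (b :- x) :* d) refl _ _ _ _ ⟩
    (x - a) * b ⁻¹ + (b - x) * b ⁻¹      ≤⟨ +-monoˡ-≤ _ (*-monoʳ-≤ (x≤y⇒0≤y-x a≤x) (⁻¹-antimono-≤ 0<x x≤b)) ⟩
    (x - a) * x ⁻¹ + (b - x) * b ⁻¹      ∎
    where open ≤-Reasoning

  -- Inserting the cut `x` refines the cell that contains it, and refinement can only raise a lower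
  -- sum; hence an inequality.
  LowerSum-split : ∀ {a x b s} → 0# < a → a ≤ x → x ≤ b → LowerSum a b s →
    ∃₂ λ s₁ s₂ → LowerSum a x s₁ × LowerSum x b s₂ × s ≤ s₁ + s₂
  LowerSum-split 0<a a≤x x≤b (single a≤b s≈) =
    _ , _ , single a≤x refl , single x≤b refl ,
    ≤-respˡ-≈ (sym s≈) (split-term (<-≤-trans 0<a a≤x) a≤x x≤b)
  LowerSum-split {a} {x} {b} {t} 0<a a≤x x≤b (cons {c} {s} a≤c S t≈) with ≤-total x c
  ... | inj₁ x≤c = _ , _ , single a≤x refl , cons x≤c S refl , (begin
    t                                            ≈⟨ t≈ ⟩
    (c - a) * c ⁻¹ + s                           ≤⟨ +-monoˡ-≤ s (split-term (<-≤-trans 0<a a≤x) a≤x x≤c) ⟩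
    (x - a) * x ⁻¹ + (c - x) * c ⁻¹ + s          ≈⟨ +-assoc _ _ _ ⟩
    (x - a) * x ⁻¹ + ((c - x) * c ⁻¹ + s)        ∎)
    where open ≤-Reasoning
  ... | inj₂ c≤x with LowerSum-split (<-≤-trans 0<a a≤c) c≤x x≤b S
  ...   | s₁ , s₂ , S₁ , S₂ , s≤ = _ , _ , cons a≤c S₁ refl , S₂ ,
    ≤-respˡ-≈ (sym t≈) (≤-respʳ-≈ (sym (+-assoc _ _ _)) (+-monoʳ-≤ _ s≤))

  Darboux : Carrier → Carrier → Set
  Darboux x s = ∃ λ ts → let partition = 1# ∷ ts ++ [ x ] in
    Linked _≤_ partition × s ≈ lowerSum partition

  Darboux⇒LowerSum : ∀ {x s} → Darboux x s → LowerSum 1# x s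
  Darboux⇒LowerSum (ts , linked , s≈) = LowerSum-resp (sym s≈) (lowerSum⇒LowerSum ts linked)

  Darboux-upper : ∀ {x} → UpperBound (Darboux x) (x - 1#)
  Darboux-upper {x} {s} D = begin
    s                  ≤⟨ LowerSum-upper 0<1 (Darboux⇒LowerSum D) ⟩
    (x - 1#) * 1# ⁻¹   ≈⟨ *-congˡ (⁻¹-unique (*-identityˡ 1#)) ⟨
    (x - 1#) * 1#      ≈⟨ *-identityʳ _ ⟩
    x - 1#             ∎
    where open ≤-Reasoning

  ln-upper : ∀ {x s} → 1# ≤ x → LowerSum 1# x s → s ≤ ln x
  ln-upper {x} 1≤x S with lem {1# ≤ x}
  ... | yes _   = sup-upper (Darboux x) (x - 1# , λ {s} → Darboux-upper {x} {s}) (LowerSum⇒lowerSum S)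
  ... | no  1≰x = ⊥-elim (1≰x 1≤x)

  ln-least : ∀ {x b} → 1# ≤ x → (∀ {s} → LowerSum 1# x s → s ≤ b) → ln x ≤ b
  ln-least {x} 1≤x ub with lem {1# ≤ x}
  ... | yes _   = sup-least (Darboux x) (_ , LowerSum⇒lowerSum (single 1≤x refl))
                    λ D → ub (Darboux⇒LowerSum D)
  ... | no  1≰x = ⊥-elim (1≰x 1≤x)

  ln-≤ : ∀ {x} → 1# ≤ x → ln x ≤ x - 1#
  ln-≤ 1≤x = ln-least 1≤x λ S → Darboux-upper (LowerSum⇒lowerSum S)

  ln-≥ : ∀ {x} → 1# ≤ x → (x - 1#) * x ⁻¹ ≤ ln x
  ln-≥ 1≤x = ln-upper 1≤x (single 1≤x refl)

  ln-nonNeg : ∀ {x} → 1# ≤ x → 0# ≤ ln x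
  ln-nonNeg 1≤x = ≤-trans
    (*-nonNeg (x≤y⇒0≤y-x 1≤x) (⁻¹-nonNeg (1≤x⇒0<x 1≤x))) (ln-≥ 1≤x)

  ln-pos : ∀ {x} → 1# < x → 0# < ln x
  ln-pos 1<x@(1≤x , _) = <-≤-trans
    (*-pos (x<y⇒0<y-x 1<x) (⁻¹-pos (1≤x⇒0<x 1≤x))) (ln-≥ 1≤x)

  ln-mono-≤ : ∀ {x y} → 1# ≤ x → x ≤ y → ln x ≤ ln y
  ln-mono-≤ {x} {y} 1≤x x≤y = ln-least 1≤x λ S → ≤-trans
    (x≤x+y (*-nonNeg (x≤y⇒0≤y-x x≤y) (⁻¹-nonNeg (1≤x⇒0<x 1≤y))))
    (ln-upper 1≤y (LowerSum-++ S (single x≤y refl)))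
    where 1≤y = ≤-trans 1≤x x≤y

  1≤x*y : ∀ {x y} → 1# ≤ x → 1# ≤ y → 1# ≤ x * y
  1≤x*y {x} {y} 1≤x 1≤y = ≤-respˡ-≈ (*-identityʳ 1#)
    (*-mono-≤ 0≤1 (proj₁ (1≤x⇒0<x 1≤x)) 1≤x 1≤y)

  x≤x*y : ∀ {x y} → 0# ≤ x → 1# ≤ y → x ≤ x * y
  x≤x*y 0≤x 1≤y = ≤-respˡ-≈ (*-identityʳ _) (*-monoʳ-≤ 0≤x 1≤y)

  -- A partition of [1, y] dilated by `x` continues a partition of [1, x] up to `x * y`. The
  -- supremum over the second partition is taken with the first one fixed.
  ln-*-≥ : ∀ {x y} → 1# ≤ x → 1# ≤ y → ln x + ln y ≤ ln (x * y)
  ln-*-≥ {x} {y} 1≤x 1≤y = ≤-witness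
    (x≤y⇒0≤y-x (ln-least 1≤x λ {s} S → ≤-witness
      (x≤y⇒0≤y-x (ln-least 1≤y λ {t} T → ≤-witness
        (x≤y⇒0≤y-x (ln-upper (1≤x*y 1≤x 1≤y)
          (LowerSum-++ S (LowerSum-scale (1≤x⇒0<x 1≤x) 0<1 (sym (*-identityʳ x)) refl T))))
        (solve 3 (λ c s t → c :- s :- t := c :- (s :+ t)) refl (ln (x * y)) s t)))
      (solve 3 (λ c s l → c :- l :- s := c :- s :- l) refl (ln (x * y)) s (ln y))))
    (solve 3 (λ c a b → c :- (a :+ b) := c :- b :- a) refl (ln (x * y)) (ln x) (ln y))

  -- Conversely, a partition of [1, x y] is cut at `x`, and its second half is dilated back by
  -- `x ⁻¹`.
  ln-*-≤ : ∀ {x y} → 1# ≤ x → 1# ≤ y → ln (x * y) ≤ ln x + ln y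
  ln-*-≤ {x} {y} 1≤x 1≤y = ln-least (1≤x*y 1≤x 1≤y) λ S →
    let s₁ , s₂ , S₁ , S₂ , s≤ = LowerSum-split 0<1 1≤x (x≤x*y (proj₁ (1≤x⇒0<x 1≤x)) 1≤y) S
    in ≤-trans s≤ (+-mono-≤ (ln-upper 1≤x S₁)
         (ln-upper 1≤y (LowerSum-scale (⁻¹-pos 0<x) 0<x
           (sym (⁻¹-inverseˡ (0<x⇒x≉0 0<x)))
           (trans (sym (*-identityˡ y)) (trans (*-congʳ (sym (⁻¹-inverseˡ (0<x⇒x≉0 0<x)))) (*-assoc _ _ _)))
           S₂)))
    where 0<x = 1≤x⇒0<x 1≤x

  ln-^-≥ : ∀ {x} → 1# ≤ x → ∀ n → fromℕ n * ln x ≤ ln (x ^ n)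
  ln-^-≥ {x} 1≤x zero    = ≤-respˡ-≈ (sym (zeroˡ _)) (ln-nonNeg ≤-refl)
  ln-^-≥ {x} 1≤x (suc n) = begin
    (1# + fromℕ n) * ln x     ≈⟨ solve 2 (λ k l → (:1 :+ k) :* l := l :+ k :* l) refl _ _ ⟩
    ln x + fromℕ n * ln x     ≤⟨ +-monoʳ-≤ _ (ln-^-≥ 1≤x n) ⟩
    ln x + ln (x ^ n)         ≤⟨ ln-*-≥ 1≤x (1≤x^n 1≤x n) ⟩
    ln (x * x ^ n)            ∎
    where open ≤-Reasoning

  ln-^-≤ : ∀ {x} → 1# ≤ x → ∀ n → ln (x ^ n) ≤ fromℕ n * ln x
  ln-^-≤ {x} 1≤x zero    = ≤-respʳ-≈ (trans (-‿inverseʳ 1#) (sym (zeroˡ _))) (ln-≤ ≤-refl)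
  ln-^-≤ {x} 1≤x (suc n) = begin
    ln (x * x ^ n)            ≤⟨ ln-*-≤ 1≤x (1≤x^n 1≤x n) ⟩
    ln x + ln (x ^ n)         ≤⟨ +-monoʳ-≤ _ (ln-^-≤ 1≤x n) ⟩
    ln x + fromℕ n * ln x     ≈⟨ solve 2 (λ k l → (:1 :+ k) :* l := l :+ k :* l) refl _ _ ⟨
    (1# + fromℕ n) * ln x     ∎
    where open ≤-Reasoning

-- Diameters of planar point sets

module PlanarDiameterGraph (lem : ExcludedMiddle 0ℓ) (ℝ : CompleteOrderedField) where

  open Supremum lem ℝ public

  x²≤0⇒x≈0 : ∀ {x} → x * x ≤ 0# → x ≈ 0#
  x²≤0⇒x≈0 {x} x²≤0 = antisym
    (square-cancel-≤ ≤-refl (≤-respʳ-≈ (sym (zeroˡ 0#)) x²≤0))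
    (≤-witness (x≤y⇒0≤y-x (square-cancel-≤ ≤-refl (≤-respˡ-≈
        (solve 1 (λ x → x :* x := (:0 :- x) :* (:0 :- x)) refl x)
        (≤-respʳ-≈ (sym (zeroˡ 0#)) x²≤0))))
      (solve 1 (λ x → x :- :0 := :0 :- (:0 :- x)) refl x))

  -- The trailing `0#` makes this definitionally the radicand of `dist` in dimension 2.
  sqDist : Point 2 → Point 2 → Carrier
  sqDist x y = (x zero - y zero) * (x zero - y zero)
    + ((x (suc zero) - y (suc zero)) * (x (suc zero) - y (suc zero)) + 0#)

  -- Twice the signed area of the triangle xyz, positive when `z` lies to the left of the ray from
  -- `x` to `y`.
  cross : Point 2 → Point 2 → Point 2 → Carrier
  cross x y z = (y zero - x zero) * (z (suc zero) - x (suc zero))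
    - (y (suc zero) - x (suc zero)) * (z zero - x zero)

  sqDist-nonNeg : ∀ x y → 0# ≤ sqDist x y
  sqDist-nonNeg x y = +-nonNeg (0≤x² _) (+-nonNeg (0≤x² _) ≤-refl)

  sqDist-sym : ∀ x y → sqDist x y ≈ sqDist y x
  sqDist-sym x y = solve 4 (λ a b c d →
    (a :- c) :* (a :- c) :+ ((b :- d) :* (b :- d) :+ :0) :=
    (c :- a) :* (c :- a) :+ ((d :- b) :* (d :- b) :+ :0)) refl _ _ _ _

  -- When `x z` and `y w` are as long as `x y`, the differences `sqDist x y - sqDist x z` and
  -- `sqDist x y - sqDist y w` vanish, and the identity shows that zw exceeds xy once the product of
  -- the two areas is positive. With these differences kept, it holds for all eight coordinates and
  -- the solver can check it.
  opposite-identity : ∀ x y z w →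
    fromℕ 2 * sqDist x y * (sqDist z w - sqDist x y
      + ((sqDist x y - sqDist x z) + (sqDist x y - sqDist y w)))
    ≈ (sqDist y z + (sqDist x y - sqDist x z)) * (sqDist x w + (sqDist x y - sqDist y w))
      + fromℕ 4 * (cross x y z * cross y x w)
  opposite-identity x y z w = solve 8 (λ x₀ x₁ y₀ y₁ z₀ z₁ w₀ w₁ →
    let :sq a₀ a₁ b₀ b₁ = (a₀ :- b₀) :* (a₀ :- b₀) :+ ((a₁ :- b₁) :* (a₁ :- b₁) :+ :0)
        :cross a₀ a₁ b₀ b₁ c₀ c₁ = (b₀ :- a₀) :* (c₁ :- a₁) :- (b₁ :- a₁) :* (c₀ :- a₀)
        xy = :sq x₀ x₁ y₀ y₁
        xz = :sq x₀ x₁ z₀ z₁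
        yw = :sq y₀ y₁ w₀ w₁
        zw = :sq z₀ z₁ w₀ w₁
        yz = :sq y₀ y₁ z₀ z₁
        xw = :sq x₀ x₁ w₀ w₁
    in :2 :* xy :* (zw :- xy :+ ((xy :- xz) :+ (xy :- yw)))
      := (yz :+ (xy :- xz)) :* (xw :+ (xy :- yw))
        :+ :4 :* (:cross x₀ x₁ y₀ y₁ z₀ z₁ :* :cross y₀ y₁ x₀ x₁ w₀ w₁))
    refl _ _ _ _ _ _ _ _

  -- Heron's formula: sixteen times the squared area is `4 * cross²`, here sorted by powers of the
  -- side `y z`.
  equal-legs-identity : ∀ x y z →
    sqDist y z * (fromℕ 2 * (sqDist x y + sqDist x z) - sqDist y z)
    ≈ fromℕ 4 * (cross x y z * cross x y z)
      + (sqDist x y - sqDist x z) * (sqDist x y - sqDist x z)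
  equal-legs-identity x y z = solve 6 (λ x₀ x₁ y₀ y₁ z₀ z₁ →
    let :sq a₀ a₁ b₀ b₁ = (a₀ :- b₀) :* (a₀ :- b₀) :+ ((a₁ :- b₁) :* (a₁ :- b₁) :+ :0)
        :cross a₀ a₁ b₀ b₁ c₀ c₁ = (b₀ :- a₀) :* (c₁ :- a₁) :- (b₁ :- a₁) :* (c₀ :- a₀)
        xy = :sq x₀ x₁ y₀ y₁
        xz = :sq x₀ x₁ z₀ z₁
        yz = :sq y₀ y₁ z₀ z₁
        c = :cross x₀ x₁ y₀ y₁ z₀ z₁
    in yz :* (:2 :* (xy :+ xz) :- yz)
      := :4 :* (c :* c) :+ (xy :- xz) :* (xy :- xz))
    refl _ _ _ _ _ _

  cross-antisym : ∀ x y z → cross x z y ≈ 0# - cross x y z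
  cross-antisym x y z = solve 6 (λ x₀ x₁ y₀ y₁ z₀ z₁ →
    let :cross a₀ a₁ b₀ b₁ c₀ c₁ = (b₀ :- a₀) :* (c₁ :- a₁) :- (b₁ :- a₁) :* (c₀ :- a₀)
    in :cross x₀ x₁ z₀ z₁ y₀ y₁ := :0 :- :cross x₀ x₁ y₀ y₁ z₀ z₁) refl _ _ _ _ _ _

  x≈y⇒x-y≈0 : ∀ {x y} → x ≈ y → x - y ≈ 0#
  x≈y⇒x-y≈0 {x} {y} x≈y = trans (+-congʳ x≈y) (-‿inverseʳ y)

  -- If z and w lie on opposite sides of the line xy, then the diameters xz and yw are
  -- disjoint and do not cross, whence zw is longer than xy.
  same-side : ∀ x y z w → sqDist x z ≈ sqDist x y → sqDist y w ≈ sqDist x y →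
    sqDist z w ≤ sqDist x y → cross x y z < 0# → 0# ≤ cross y x w
  same-side x y z w xz≈xy yw≈xy zw≤xy c<0 = ≮⇒≥ λ d<0 → <⇒≱ (begin-strict
    0#                                                ≤⟨ *-nonNeg (sqDist-nonNeg y z) (sqDist-nonNeg x w) ⟩
    sqDist y z * sqDist x w                           <⟨ 0<y-x⇒x<y (<-≤-trans
      (*-pos (<-≤-trans 0<1 (1≤fromℕ[1+n] 3)) (*-pos (x<y⇒0<y-x c<0) (x<y⇒0<y-x d<0)))
      (≤-reflexive (solve 4 (λ p q c d → q :* ((:0 :- c) :* (:0 :- d)) := p :+ q :* (c :* d) :- p) refl _ _ _ _))) ⟩
    sqDist y z * sqDist x w + fromℕ 4 * (c * d)       ≈⟨ +-congʳ (*-cong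
      (trans (+-congˡ xy-xz≈0) (+-identityʳ _)) (trans (+-congˡ xy-yw≈0) (+-identityʳ _))) ⟨
    (sqDist y z + (sqDist x y - sqDist x z)) * (sqDist x w + (sqDist x y - sqDist y w))
      + fromℕ 4 * (c * d)                             ≈⟨ opposite-identity x y z w ⟨
    fromℕ 2 * sqDist x y * (sqDist z w - sqDist x y
      + ((sqDist x y - sqDist x z) + (sqDist x y - sqDist y w))) ∎)
    (begin
    fromℕ 2 * sqDist x y * (sqDist z w - sqDist x y
      + ((sqDist x y - sqDist x z) + (sqDist x y - sqDist y w))) ≤⟨
      *-monoʳ-≤ (*-nonNeg (fromℕ-nonNeg 2) (sqDist-nonNeg x y)) (begin
        sqDist z w - sqDist x y + ((sqDist x y - sqDist x z) + (sqDist x y - sqDist y w))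
          ≈⟨ +-congˡ (+-cong xy-xz≈0 xy-yw≈0) ⟩
        sqDist z w - sqDist x y + (0# + 0#)  ≤⟨ +-monoˡ-≤ _ (+-monoˡ-≤ _ zw≤xy) ⟩
        sqDist x y - sqDist x y + (0# + 0#)  ≈⟨ solve 1 (λ a → a :- a :+ (:0 :+ :0) := :0) refl _ ⟩
        0#                                   ∎) ⟩
    fromℕ 2 * sqDist x y * 0#                         ≈⟨ zeroʳ _ ⟩
    0#                                                ∎)
    where
    open ≤-Reasoning
    c = cross x y z
    d = cross y x w
    xy-xz≈0 = x≈y⇒x-y≈0 (sym xz≈xy)
    xy-yw≈0 = x≈y⇒x-y≈0 (sym yw≈xy)

  -- On a line, equal legs from `x` leave either `z = y` or `y z` twice as long as `x y`, and the
  -- bound on `y z` excludes the latter. In Heron's formula the right side vanishes, while the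
  -- second factor on the left is at least `e`.
  collinear-legs : ∀ x y z → sqDist x z ≈ sqDist x y → sqDist y z ≤ sqDist x y →
    cross x y z ≈ 0# → sqDist y z ≈ 0#
  collinear-legs x y z xz≈xy yz≤xy c≈0 = x²≤0⇒x≈0 (begin
    e * e                                     ≤⟨ *-monoʳ-≤ 0≤e (≤-witness
      (+-nonNeg (+-nonNeg (x≤y⇒0≤y-x yz≤xy) (x≤y⇒0≤y-x yz≤xz))
                (+-nonNeg (sqDist-nonNeg x y) (sqDist-nonNeg x z)))
      (solve 3 (λ a b e → :2 :* (a :+ b) :- e :- e := ((a :- e) :+ (b :- e)) :+ (a :+ b)) refl _ _ _)) ⟩
    e * (fromℕ 2 * (sqDist x y + sqDist x z) - e)     ≈⟨ equal-legs-identity x y z ⟩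
    fromℕ 4 * (cross x y z * cross x y z) + (sqDist x y - sqDist x z) * (sqDist x y - sqDist x z)
      ≈⟨ +-cong (*-congˡ (*-cong c≈0 c≈0)) (*-cong xy-xz≈0 xy-xz≈0) ⟩
    fromℕ 4 * (0# * 0#) + 0# * 0#             ≈⟨ solve 1 (λ q → q :* (:0 :* :0) :+ :0 :* :0 := :0) refl _ ⟩
    0#                                        ∎)
    where
    open ≤-Reasoning
    e = sqDist y z
    0≤e = sqDist-nonNeg y z
    yz≤xz = ≤-respʳ-≈ (sym xz≈xy) yz≤xy
    xy-xz≈0 = x≈y⇒x-y≈0 (sym xz≈xy)

  sqDist≈0 : ∀ x y → sqDist x y ≈ 0# → ∀ c → x c ≈ y c
  sqDist≈0 x y xy≈0 c = diff≈0⇒≈ (x²≤0⇒x≈0 (≤-respʳ-≈ xy≈0 (square≤ c)))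
    where
    diff≈0⇒≈ : ∀ {a b} → a - b ≈ 0# → a ≈ b
    diff≈0⇒≈ {a} {b} a-b≈0 = trans (solve 2 (λ a b → a := a :- b :+ b) refl a b)
      (trans (+-congʳ a-b≈0) (+-identityˡ b))
    square≤ : ∀ c → (x c - y c) * (x c - y c) ≤ sqDist x y
    square≤ zero       = x≤x+y (+-nonNeg (0≤x² _) ≤-refl)
    square≤ (suc zero) = ≤-trans (x≤x+y ≤-refl) (x≤y+x (0≤x² _))

  module _ {m} (pts : Fin m → Point 2) where

    Diametral : Fin m → Fin m → Set
    Diametral i j = ∀ k l → sqDist (pts k) (pts l) ≤ sqDist (pts i) (pts j)

    diameterGraph⇒Diametral : ∀ {i j} → diameterGraph pts i j → Diametral i j
    diameterGraph⇒Diametral {i} {j} (_ , _ , dist≤) k l = √-cancel-≤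
      (sqDist-nonNeg (pts k) (pts l)) (sqDist-nonNeg (pts i) (pts j)) (dist≤ k l)

    Diametral-sym : ∀ {i j} → Diametral i j → Diametral j i
    Diametral-sym {i} {j} ij k l = ≤-respʳ-≈ (sqDist-sym (pts i) (pts j)) (ij k l)

    Diametral-≈ : ∀ {i j k l} → Diametral i j → Diametral k l →
      sqDist (pts k) (pts l) ≈ sqDist (pts i) (pts j)
    Diametral-≈ ij kl = antisym (ij _ _) (kl _ _)

    -- The edge from `i` to `j` is clockwise last at `i`. Two diameters at a common point enclose an
    -- angle of at most 60 degrees, so the sign of `cross` orders them.
    Last : Fin m → Fin m → Set
    Last i j = Diametral i j × (∀ k → Diametral i k → 0# ≤ cross (pts i) (pts j) (pts k))

    ¬Last⇒ : ∀ {i j} → Diametral i j → ¬ Last i j →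
      ∃ λ k → Diametral i k × cross (pts i) (pts j) (pts k) < 0#
    ¬Last⇒ {i} {j} ij ¬last
      with lem {∃ λ k → Diametral i k × cross (pts i) (pts j) (pts k) < 0#}
    ... | yes found = found
    ... | no  none  = ⊥-elim (¬last (ij , λ k ik → ≮⇒≥ λ c<0 → none (k , ik , c<0)))

    -- A single diameter `i k` clockwise beyond `i j` forces, by `same-side`, every diameter at `j`
    -- to end on the side of `k` or on the line `i j` itself. Seen from `j`, that is the
    -- counterclockwise side.
    Last-total : ∀ {i j} → Diametral i j → Last i j ⊎ Last j i
    Last-total {i} {j} ij with lem {Last i j}
    ... | yes last  = inj₁ last
    ... | no  ¬last with ¬Last⇒ ij ¬last
    ...   | k , ik , c<0 = inj₂ (Diametral-sym ij , λ l jl →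
      same-side (pts i) (pts j) (pts k) (pts l) (Diametral-≈ ij ik) (Diametral-≈ ij jl) (ij k l) c<0)

    -- Each of the two edges is clockwise of the other, so by antisymmetry the area is zero, and
    -- collinear diameters from one point coincide.
    Last-functional : Distinct pts → ∀ {i j k} → Last i j → Last i k → j ≡ k
    Last-functional distinct {i} {j} {k} (ij , last-j) (ik , last-k) =
      distinct (sqDist≈0 (pts j) (pts k)
        (collinear-legs (pts i) (pts j) (pts k) (Diametral-≈ ij ik) (ij j k) (antisym
          (≤-witness (≤-respʳ-≈ (cross-antisym (pts i) (pts j) (pts k)) (last-k j ij)) refl)
          (last-j k ik))))

-- Counting edges by charging them to endpoints

module Counting where

  open Algebra.Properties.CommutativeMonoid.Sum ℕ.+-0-commutativeMonoid
    using (sum; ∑-distrib-+)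

  -- Counting row by row follows the recursion of `weight`, so that powers of `μ` factor in the same
  -- way as probabilities.
  edges : ∀ {n} → LabelledGraph n → Subset n → ℕ
  edges []      []            = 0
  edges (s ∷ g) (outside ∷ W) = edges g W
  edges (s ∷ g) (inside  ∷ W) = ∣ s ∩ W ∣ ℕ.+ edges g W

  ∣S∣≤sum : ∀ {n} (S : Subset n) {t : Fin n → ℕ} → (∀ {i} → i ∈ S → 1 ℕ.≤ t i) → ∣ S ∣ ℕ.≤ sum t
  ∣S∣≤sum []            1≤t = ℕ.z≤n
  ∣S∣≤sum (outside ∷ S) 1≤t = ℕ.m≤n⇒m≤o+n _ (∣S∣≤sum S (1≤t ∘ there))
  ∣S∣≤sum (inside  ∷ S) 1≤t = ℕ.+-mono-≤ (1≤t here) (∣S∣≤sum S (1≤t ∘ there))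

  sum≤∣S∣ : ∀ {n} (S : Subset n) {t : Fin n → ℕ} → (∀ i → t i ℕ.≤ 1) →
    (∀ i → 1 ℕ.≤ t i → i ∈ S) → sum t ℕ.≤ ∣ S ∣
  sum≤∣S∣ []            t≤1 supp = ℕ.z≤n
  sum≤∣S∣ (outside ∷ S) {t} t≤1 supp with t zero in eq
  ... | zero  = sum≤∣S∣ S (t≤1 ∘ suc) λ i 1≤t → drop-there (supp (suc i) 1≤t)
  ... | suc _ with () ← supp zero (ℕ.≤-trans (ℕ.s≤s ℕ.z≤n) (ℕ.≤-reflexive (≡.sym eq)))
  sum≤∣S∣ (inside  ∷ S) t≤1 supp = ℕ.+-mono-≤ (t≤1 zero)
    (sum≤∣S∣ S (t≤1 ∘ suc) λ i 1≤t → drop-there (supp (suc i) 1≤t))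

  sum≡0 : ∀ {n} (t : Fin n → ℕ) → (∀ i → t i ≡ 0) → sum t ≡ 0
  sum≡0 {zero}  t t≡0 = ≡.refl
  sum≡0 {suc n} t t≡0 = ≡.cong₂ ℕ._+_ (t≡0 zero) (sum≡0 (t ∘ suc) (t≡0 ∘ suc))

  indicator : {A : Set} → Dec A → ℕ
  indicator A? = if does A? then 1 else 0

  1≤indicator : ∀ {A : Set} (A? : Dec A) → A → 1 ℕ.≤ indicator A?
  1≤indicator (yes _) _ = ℕ.≤-refl
  1≤indicator (no ¬a) a = ⊥-elim (¬a a)

  sum-indicator≤1 : ∀ {n} {P : Fin n → Set} (P? : ∀ i → Dec (P i)) →
    (∀ {i j} → P i → P j → i ≡ j) → sum (λ i → indicator (P? i)) ℕ.≤ 1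
  sum-indicator≤1 {zero}  P? unique = ℕ.z≤n
  sum-indicator≤1 {suc n} P? unique with P? zero
  ... | no  _  = sum-indicator≤1 (P? ∘ suc) λ p q → suc-injective (unique p q)
  ... | yes p₀ = ℕ.≤-reflexive (≡.cong suc (sum≡0 _ λ i → vanish (P? (suc i)) λ p → 0≢1+n (unique p₀ p)))
    where
    vanish : ∀ {A : Set} (A? : Dec A) → ¬ A → indicator A? ≡ 0
    vanish (yes a) ¬a = ⊥-elim (¬a a)
    vanish (no _)  _  = ≡.refl

  -- Each edge inside `W` is charged to one of the two matrix entries `(i , j)` and `(j , i)`. In
  -- the induction the first row and the first column pay for the edges at vertex 0, and the
  -- remaining minor pays for the others.
  edges≤sum : ∀ {n} (g : LabelledGraph n) (W : Subset n) (r : Fin n → Fin n → ℕ) →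
    (∀ {i j} → i ∈ W → j ∈ W → edge? g i j ≡ true → 1 ℕ.≤ r i j ℕ.+ r j i) →
    edges g W ℕ.≤ sum (λ i → sum (r i))
  edges≤sum []      []            r cover = ℕ.z≤n
  edges≤sum (s ∷ g) (outside ∷ W) r cover = begin
    edges g W
      ≤⟨ edges≤sum g W _ (λ i∈W j∈W → cover (there i∈W) (there j∈W)) ⟩
    sum rest
      ≤⟨ ℕ.m≤n+m _ _ ⟩
    sum col ℕ.+ sum rest
      ≡⟨ ∑-distrib-+ col rest ⟨
    sum (λ i → sum (r (suc i)))
      ≤⟨ ℕ.m≤n+m _ _ ⟩
    sum (r zero) ℕ.+ sum (λ i → sum (r (suc i))) ∎
    where
    open ℕ.≤-Reasoning
    col = λ i → r (suc i) zero
    rest = λ i → sum (λ j → r (suc i) (suc j))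
  edges≤sum (s ∷ g) (inside  ∷ W) r cover = begin
    ∣ s ∩ W ∣ ℕ.+ edges g W
      ≤⟨ ℕ.+-mono-≤ first-row (edges≤sum g W _ (λ i∈W j∈W → cover (there i∈W) (there j∈W))) ⟩
    (sum row ℕ.+ sum col) ℕ.+ sum rest
      ≡⟨ ℕ.+-assoc (sum row) (sum col) _ ⟩
    sum row ℕ.+ (sum col ℕ.+ sum rest)
      ≡⟨ ≡.cong (sum row ℕ.+_) (∑-distrib-+ col rest) ⟨
    sum row ℕ.+ sum (λ i → sum (r (suc i)))
      -- The diagonal entry, which no edge is charged to, is added to complete the row.
      ≤⟨ ℕ.+-monoˡ-≤ _ (ℕ.m≤n+m (sum row) (r zero zero)) ⟩
    sum (r zero) ℕ.+ sum (λ i → sum (r (suc i))) ∎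
    where
    open ℕ.≤-Reasoning
    row = λ j → r zero (suc j)
    col = λ i → r (suc i) zero
    rest = λ i → sum (λ j → r (suc i) (suc j))
    first-row : ∣ s ∩ W ∣ ℕ.≤ sum row ℕ.+ sum col
    first-row = ℕ.≤-trans
      (∣S∣≤sum (s ∩ W) λ j∈ → let j∈s , j∈W = x∈p∩q⁻ s W j∈ in
        cover here (there j∈W) ([]=⇒lookup j∈s))
      (ℕ.≤-reflexive (∑-distrib-+ row col))

  -- The relation `R` orients every edge of `W` in at least one direction with at most one arrow
  -- leaving each vertex: row sums are at most 1 and vanish outside `W`.
  edges≤∣W∣ : ∀ {n} (g : LabelledGraph n) (W : Subset n) {R : Fin n → Fin n → Set} →
    (∀ i j → Dec (R i j)) →
    (∀ {i j} → i ∈ W → j ∈ W → edge? g i j ≡ true → R i j ⊎ R j i) →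
    (∀ {i j} → R i j → i ∈ W) →
    (∀ {i j k} → R i j → R i k → j ≡ k) →
    edges g W ℕ.≤ ∣ W ∣
  edges≤∣W∣ g W R? cover dom functional = ℕ.≤-trans
    (edges≤sum g W (λ i j → indicator (R? i j)) λ i∈W j∈W e →
      [ (λ r → ℕ.m≤n⇒m≤n+o _ (1≤indicator (R? _ _) r))
      , (λ r → ℕ.m≤n⇒m≤o+n _ (1≤indicator (R? _ _) r)) ]′ (cover i∈W j∈W e))
    (sum≤∣S∣ W (λ i → sum-indicator≤1 (R? i) functional) λ i 1≤ →
      dom (proj₂ (find (R? i) 1≤)))
    where
    find : ∀ {n} {P : Fin n → Set} (P? : ∀ i → Dec (P i)) → 1 ℕ.≤ sum (λ i → indicator (P? i)) → ∃ P
    find {suc n} P? 1≤ with P? zero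
    ... | yes p = zero , p
    ... | no  _ = let i , p = find (P? ∘ suc) 1≤ in suc i , p

-- The edge bound for planar diameter graphs

module HopfPannwitz (lem : ExcludedMiddle 0ℓ) (ℝ : CompleteOrderedField) where

  open PlanarDiameterGraph lem ℝ
  open Counting public

  planar-diameterGraph-edges : ∀ {n} (g : LabelledGraph n) (W : Subset n) →
    IsDiameterGraph 2 (induced g W) → edges g W ℕ.≤ ∣ W ∣
  planar-diameterGraph-edges {n} g W (m , pts , distinct , iso , edge⇔) =
    edges≤∣W∣ g W {R} (λ _ _ → lem) cover proj₁ functional
    where
    open Inverse iso using (to)
    open Injection (↔⇒↣ iso) using (injective)
    -- The relation `Last` is pulled back along the isomorphism; the membership proofs are carried
    -- along because vertices of the induced graph are pairs.
    R : Fin n → Fin n → Set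
    R i j = Σ (i ∈ W) λ i∈W → Σ (j ∈ W) λ j∈W → Last pts (to (i , i∈W)) (to (j , j∈W))
    cover : ∀ {i j} → i ∈ W → j ∈ W → edge? g i j ≡ true → R i j ⊎ R j i
    cover i∈W j∈W e = map⊎ (λ last → i∈W , j∈W , last) (λ last → j∈W , i∈W , last)
      (Last-total pts (diameterGraph⇒Diametral pts (Equivalence.to (edge⇔ (_ , i∈W) (_ , j∈W)) e)))
    functional : ∀ {i j k} → R i j → R i k → j ≡ k
    functional {i} {j} {k} (i∈W , j∈W , last-j) (i∈W′ , k∈W , last-k) =
      -- The two facts may come with different proofs of `i ∈ W`; irrelevance makes them speak of
      -- the same point.
      ≡.cong proj₁ (injective (Last-functional pts distinct last-j
        (≡.subst (λ i∈W → Last pts (to (i , i∈W)) (to (k , k∈W))) ([]=-irrelevant i∈W′ i∈W) last-k)))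

-- Generating functions and the union bound

module UnionBound (lem : ExcludedMiddle 0ℓ) (ℝ : CompleteOrderedField) where

  open OrderedField lem ℝ
  open Counting

  ∑ : {A : Set} → List A → (A → Carrier) → Carrier
  ∑ xs f = foldr _+_ 0# (map f xs)

  ∑-cong : ∀ {A : Set} (xs : List A) {f g : A → Carrier} → (∀ x → f x ≈ g x) → ∑ xs f ≈ ∑ xs g
  ∑-cong []       f≈g = refl
  ∑-cong (x ∷ xs) f≈g = +-cong (f≈g x) (∑-cong xs f≈g)

  ∑-mono-≤ : ∀ {A : Set} (xs : List A) {f g : A → Carrier} → (∀ x → f x ≤ g x) → ∑ xs f ≤ ∑ xs g
  ∑-mono-≤ []       f≤g = ≤-refl
  ∑-mono-≤ (x ∷ xs) f≤g = +-mono-≤ (f≤g x) (∑-mono-≤ xs f≤g)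

  ∑-nonNeg : ∀ {A : Set} (xs : List A) {f : A → Carrier} → (∀ x → 0# ≤ f x) → 0# ≤ ∑ xs f
  ∑-nonNeg []       0≤f = ≤-refl
  ∑-nonNeg (x ∷ xs) 0≤f = +-nonNeg (0≤f x) (∑-nonNeg xs 0≤f)

  ∑-++ : ∀ {A : Set} (xs ys : List A) (f : A → Carrier) → ∑ (xs ++ ys) f ≈ ∑ xs f + ∑ ys f
  ∑-++ []       ys f = sym (+-identityˡ _)
  ∑-++ (x ∷ xs) ys f = trans (+-congˡ (∑-++ xs ys f)) (sym (+-assoc _ _ _))

  ∑-map : ∀ {A B : Set} (h : A → B) (xs : List A) (f : B → Carrier) → ∑ (map h xs) f ≈ ∑ xs (f ∘ h)
  ∑-map h []       f = refl
  ∑-map h (x ∷ xs) f = +-congˡ (∑-map h xs f)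

  ∑-*ˡ : ∀ {A : Set} (xs : List A) c (f : A → Carrier) → ∑ xs (λ x → c * f x) ≈ c * ∑ xs f
  ∑-*ˡ []       c f = sym (zeroʳ c)
  ∑-*ˡ (x ∷ xs) c f = trans (+-congˡ (∑-*ˡ xs c f)) (sym (distribˡ c _ _))

  ∑-*ʳ : ∀ {A : Set} (xs : List A) c (f : A → Carrier) → ∑ xs (λ x → f x * c) ≈ ∑ xs f * c
  ∑-*ʳ xs c f = trans (∑-cong xs (λ x → *-comm (f x) c)) (trans (∑-*ˡ xs c f) (*-comm c _))

  ∑-+ : ∀ {A : Set} (xs : List A) (f g : A → Carrier) → ∑ xs (λ x → f x + g x) ≈ ∑ xs f + ∑ xs g
  ∑-+ []       f g = sym (+-identityˡ 0#)
  ∑-+ (x ∷ xs) f g = trans (+-congˡ (∑-+ xs f g))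
    (solve 4 (λ a b c d → a :+ b :+ (c :+ d) := a :+ c :+ (b :+ d)) refl _ _ _ _)

  ∑-0 : ∀ {A : Set} (xs : List A) → ∑ xs (λ _ → 0#) ≈ 0#
  ∑-0 []       = refl
  ∑-0 (x ∷ xs) = trans (+-identityˡ _) (∑-0 xs)

  ∑-comm : ∀ {A B : Set} (xs : List A) (ys : List B) (f : A → B → Carrier) →
    ∑ xs (λ x → ∑ ys (f x)) ≈ ∑ ys (λ y → ∑ xs (λ x → f x y))
  ∑-comm []       ys f = sym (∑-0 ys)
  ∑-comm (x ∷ xs) ys f = trans (+-congˡ (∑-comm xs ys f)) (sym (∑-+ ys (f x) _))

  ∑-cartesianProductWith : ∀ {A B C : Set} (h : A → B → C) (xs : List A) (ys : List B)
    (f : C → Carrier) →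
    ∑ (cartesianProductWith h xs ys) f ≈ ∑ xs (λ x → ∑ ys (λ y → f (h x y)))
  ∑-cartesianProductWith h []       ys f = refl
  ∑-cartesianProductWith h (x ∷ xs) ys f = trans (∑-++ (map (h x) ys) _ f)
    (+-cong (∑-map (h x) ys f) (∑-cartesianProductWith h xs ys f))

  ∑-∈ : ∀ {A : Set} {xs : List A} {f : A → Carrier} → (∀ x → 0# ≤ f x) →
    ∀ {x} → x ∈ₗ xs → f x ≤ ∑ xs f
  ∑-∈ {xs = _ ∷ xs} 0≤f (here ≡.refl) = x≤x+y (∑-nonNeg xs 0≤f)
  ∑-∈ {xs = _ ∷ xs} 0≤f (there x∈xs)  = ≤-trans (∑-∈ 0≤f x∈xs) (x≤y+x (0≤f _))

  ∈-allSubsets : ∀ {n} (W : Subset n) → W ∈ₗ allSubsets n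
  ∈-allSubsets []            = here ≡.refl
  ∈-allSubsets (outside ∷ W) = ∈-++⁺ˡ (∈-map⁺ (outside ∷_) (∈-allSubsets W))
  ∈-allSubsets (inside  ∷ W) = ∈-++⁺ʳ (map (outside ∷_) (allSubsets _)) (∈-map⁺ (inside ∷_) (∈-allSubsets W))

  ∑-allSubsets : ∀ n (f : Subset (suc n) → Carrier) →
    ∑ (allSubsets (suc n)) f
      ≈ ∑ (allSubsets n) (λ s → f (outside ∷ s)) + ∑ (allSubsets n) (λ s → f (inside ∷ s))
  ∑-allSubsets n f = trans (∑-++ (map (outside ∷_) (allSubsets n)) _ f)
    (+-cong (∑-map (outside ∷_) (allSubsets n) f) (∑-map (inside ∷_) (allSubsets n) f))

  -- The number k(k-1)/2 of pairs in a k-set: a new vertex brings one pair for each old one.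
  tri : ℕ → ℕ
  tri zero    = 0
  tri (suc k) = k ℕ.+ tri k

  𝟙 : Set → Carrier
  𝟙 A = if does (lem {A}) then 1# else 0#

  𝟙-nonNeg : ∀ A → 0# ≤ 𝟙 A
  𝟙-nonNeg A with lem {A}
  ... | yes _ = 0≤1
  ... | no  _ = ≤-refl

  𝟙≈1 : ∀ {A} → A → 𝟙 A ≈ 1#
  𝟙≈1 {A} a with lem {A}
  ... | yes _ = refl
  ... | no ¬a = ⊥-elim (¬a a)

  𝟙-≤ : ∀ {A x} → 0# ≤ x → (A → 1# ≤ x) → 𝟙 A ≤ x
  𝟙-≤ {A} 0≤x 1≤x with lem {A}
  ... | yes a = 1≤x a
  ... | no  _ = 0≤x

  𝟙-*-cong : ∀ {A x y} → (A → x ≈ y) → 𝟙 A * x ≈ 𝟙 A * y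
  𝟙-*-cong {A} x≈y with lem {A}
  ... | yes a = *-congˡ (x≈y a)
  ... | no  _ = trans (zeroˡ _) (sym (zeroˡ _))

  subset-generating-function : ∀ n t → ∑ (allSubsets n) (λ W → t ^ ∣ W ∣) ≈ (1# + t) ^ n
  subset-generating-function zero    t = +-identityʳ 1#
  subset-generating-function (suc n) t = begin
    ∑ (allSubsets (suc n)) (λ W → t ^ ∣ W ∣)         ≈⟨ ∑-allSubsets n _ ⟩
    ∑ (allSubsets n) (λ W → t ^ ∣ W ∣) + ∑ (allSubsets n) (λ W → t * t ^ ∣ W ∣)
      ≈⟨ +-congˡ (∑-*ˡ (allSubsets n) t _) ⟩
    e + t * e                                        ≈⟨ solve 2 (λ t e → e :+ t :* e := (:1 :+ t) :* e) refl t e ⟩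
    (1# + t) * e                                     ≈⟨ *-congˡ (subset-generating-function n t) ⟩
    (1# + t) * (1# + t) ^ n                          ∎
    where
    open ≈-Reasoning
    e = ∑ (allSubsets n) (λ W → t ^ ∣ W ∣)

  *≈1⇒^≈1 : ∀ {x y} → x * y ≈ 1# → ∀ k → x ^ k * y ^ k ≈ 1#
  *≈1⇒^≈1 {x} {y} xy≈1 k = trans (sym (^-distrib-* x y k)) (trans (^-congˡ k xy≈1) (1^n≈1 k))

  -- A bound on the binomial coefficient without factorials: the indicator is at most
  -- `T ^ k * t ^ ∣ W ∣`, with equality on k-sets, and the binomial theorem sums the latter.
  count-subsets-≤ : ∀ n k {t T} → 0# ≤ t → 0# ≤ T → T * t ≈ 1# →
    ∑ (allSubsets n) (λ W → 𝟙 (∣ W ∣ ≡ k)) ≤ T ^ k * (1# + t) ^ n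
  count-subsets-≤ n k {t} {T} 0≤t 0≤T Tt≈1 = begin
    ∑ (allSubsets n) (λ W → 𝟙 (∣ W ∣ ≡ k))          ≤⟨ ∑-mono-≤ (allSubsets n) (λ W →
      𝟙-≤ (*-nonNeg (^-nonNeg 0≤T k) (^-nonNeg 0≤t ∣ W ∣))
           λ { ≡.refl → ≤-reflexive (sym (*≈1⇒^≈1 Tt≈1 ∣ W ∣)) }) ⟩
    ∑ (allSubsets n) (λ W → T ^ k * t ^ ∣ W ∣)      ≈⟨ ∑-*ˡ (allSubsets n) (T ^ k) _ ⟩
    T ^ k * ∑ (allSubsets n) (λ W → t ^ ∣ W ∣)      ≈⟨ *-congˡ (subset-generating-function n t) ⟩
    T ^ k * (1# + t) ^ n                            ∎
    where open ≤-Reasoning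

  -- The edges at one vertex are independent: a position in `W` contributes the factor
  -- `1# - p + p * μ`, and any other position contributes `(1 - p) + p = 1`.
  row-generating-function : ∀ p μ {n} (W : Subset n) →
    ∑ (allSubsets n) (λ s → rowWeight p s * μ ^ ∣ s ∩ W ∣) ≈ (1# - p + p * μ) ^ ∣ W ∣
  row-generating-function p μ []      = trans (+-identityʳ _) (*-identityʳ 1#)
  row-generating-function p μ {suc n} (w ∷ W) = begin
    ∑ (allSubsets (suc n)) (λ s → rowWeight p s * μ ^ ∣ s ∩ (w ∷ W) ∣)
      ≈⟨ ∑-allSubsets n _ ⟩
    ∑ (allSubsets n) (λ s → (1# - p) * rowWeight p s * μ ^ ∣ s ∩ W ∣)
      + ∑ (allSubsets n) (λ s → p * rowWeight p s * μ ^ ∣ w ∷ (s ∩ W) ∣)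
      ≈⟨ +-cong (∑-cong (allSubsets n) (λ s → *-assoc _ _ _))
                (∑-cong (allSubsets n) (λ s → head-inside w (s ∩ W) (rowWeight p s))) ⟩
    ∑ (allSubsets n) (λ s → (1# - p) * (rowWeight p s * μ ^ ∣ s ∩ W ∣))
      + ∑ (allSubsets n) (λ s → p * factor w * (rowWeight p s * μ ^ ∣ s ∩ W ∣))
      ≈⟨ +-cong (∑-*ˡ (allSubsets n) _ _) (∑-*ˡ (allSubsets n) _ _) ⟩
    (1# - p) * e + p * factor w * e    ≈⟨ distribʳ e _ _ ⟨
    (1# - p + p * factor w) * e        ≈⟨ *-congˡ (row-generating-function p μ W) ⟩
    (1# - p + p * factor w) * v ^ ∣ W ∣ ≈⟨ combine w ⟩
    v ^ ∣ w ∷ W ∣                      ∎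
    where
    open ≈-Reasoning
    e = ∑ (allSubsets n) (λ s → rowWeight p s * μ ^ ∣ s ∩ W ∣)
    v = 1# - p + p * μ
    factor : Side → Carrier
    factor outside = 1#
    factor inside  = μ
    head-inside : ∀ w (s : Subset n) r → p * r * μ ^ ∣ w ∷ s ∣ ≈ p * factor w * (r * μ ^ ∣ s ∣)
    head-inside outside s r = solve 3 (λ p r m → p :* r :* m := p :* :1 :* (r :* m)) refl p r _
    head-inside inside  s r = solve 4 (λ p r u m → p :* r :* (u :* m) := p :* u :* (r :* m)) refl p r μ _
    combine : ∀ w → (1# - p + p * factor w) * v ^ ∣ W ∣ ≈ v ^ ∣ w ∷ W ∣
    combine outside = solve 2 (λ p x → (:1 :- p :+ p :* :1) :* x := x) refl p _
    combine inside  = refl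

  ∑-rowWeight : ∀ p n → ∑ (allSubsets n) (rowWeight p) ≈ 1#
  ∑-rowWeight p zero    = +-identityʳ 1#
  ∑-rowWeight p (suc n) = begin
    ∑ (allSubsets (suc n)) (rowWeight p)     ≈⟨ ∑-allSubsets n _ ⟩
    ∑ (allSubsets n) (λ s → (1# - p) * rowWeight p s) + ∑ (allSubsets n) (λ s → p * rowWeight p s)
      ≈⟨ +-cong (∑-*ˡ (allSubsets n) _ _) (∑-*ˡ (allSubsets n) _ _) ⟩
    (1# - p) * e + p * e                     ≈⟨ solve 2 (λ p e → (:1 :- p) :* e :+ p :* e := e) refl p e ⟩
    e                                        ≈⟨ ∑-rowWeight p n ⟩
    1#                                       ∎
    where
    open ≈-Reasoning
    e = ∑ (allSubsets n) (rowWeight p)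

  -- This is the expectation of `μ` to the number of edges in `W`, a product over independent rows
  -- of one factor for each pair in `W`.
  graph-generating-function : ∀ p μ {n} (W : Subset n) →
    ∑ (allGraphs n) (λ g → weight p g * μ ^ edges g W) ≈ (1# - p + p * μ) ^ tri ∣ W ∣
  graph-generating-function p μ []      = trans (+-identityʳ _) (*-identityʳ 1#)
  graph-generating-function p μ {suc n} (outside ∷ W) = begin
    ∑ (allGraphs (suc n)) (λ g → weight p g * μ ^ edges g (outside ∷ W))
      ≈⟨ ∑-cartesianProductWith _∷_ (allSubsets n) (allGraphs n) _ ⟩
    ∑ (allSubsets n) (λ s → ∑ (allGraphs n) (λ g → rowWeight p s * weight p g * μ ^ edges g W))
      ≈⟨ ∑-cong (allSubsets n) (λ s → trans
           (∑-cong (allGraphs n) (λ g → *-assoc _ _ _)) (∑-*ˡ (allGraphs n) _ _)) ⟩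
    ∑ (allSubsets n) (λ s → rowWeight p s * E)      ≈⟨ ∑-*ʳ (allSubsets n) E _ ⟩
    ∑ (allSubsets n) (rowWeight p) * E              ≈⟨ *-congʳ (∑-rowWeight p n) ⟩
    1# * E                                          ≈⟨ *-identityˡ E ⟩
    E                                               ≈⟨ graph-generating-function p μ W ⟩
    (1# - p + p * μ) ^ tri ∣ W ∣                    ∎
    where
    open ≈-Reasoning
    E = ∑ (allGraphs n) (λ g → weight p g * μ ^ edges g W)
  graph-generating-function p μ {suc n} (inside ∷ W) = begin
    ∑ (allGraphs (suc n)) (λ g → weight p g * μ ^ edges g (inside ∷ W))
      ≈⟨ ∑-cartesianProductWith _∷_ (allSubsets n) (allGraphs n) _ ⟩
    ∑ (allSubsets n) (λ s → ∑ (allGraphs n) (λ g →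
      rowWeight p s * weight p g * μ ^ (∣ s ∩ W ∣ ℕ.+ edges g W)))
      ≈⟨ ∑-cong (allSubsets n) (λ s → trans
           (∑-cong (allGraphs n) (λ g → trans (*-congˡ (^-homo-* μ ∣ s ∩ W ∣ (edges g W)))
             (solve 4 (λ a b c d → a :* b :* (c :* d) := (a :* c) :* (b :* d)) refl _ _ _ _)))
           (∑-*ˡ (allGraphs n) _ _)) ⟩
    ∑ (allSubsets n) (λ s → rowWeight p s * μ ^ ∣ s ∩ W ∣ * E)     ≈⟨ ∑-*ʳ (allSubsets n) E _ ⟩
    ∑ (allSubsets n) (λ s → rowWeight p s * μ ^ ∣ s ∩ W ∣) * E
      ≈⟨ *-cong (row-generating-function p μ W) (graph-generating-function p μ W) ⟩
    v ^ ∣ W ∣ * v ^ tri ∣ W ∣                                      ≈⟨ ^-homo-* v ∣ W ∣ (tri ∣ W ∣) ⟨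
    v ^ (∣ W ∣ ℕ.+ tri ∣ W ∣)                                      ∎
    where
    open ≈-Reasoning
    v = 1# - p + p * μ
    E = ∑ (allGraphs n) (λ g → weight p g * μ ^ edges g W)

  rowWeight-nonNeg : ∀ {p} → 0# ≤ p → p ≤ 1# → ∀ {n} (s : Subset n) → 0# ≤ rowWeight p s
  rowWeight-nonNeg 0≤p p≤1 []            = 0≤1
  rowWeight-nonNeg 0≤p p≤1 (outside ∷ s) = *-nonNeg (x≤y⇒0≤y-x p≤1) (rowWeight-nonNeg 0≤p p≤1 s)
  rowWeight-nonNeg 0≤p p≤1 (inside  ∷ s) = *-nonNeg 0≤p (rowWeight-nonNeg 0≤p p≤1 s)

  weight-nonNeg : ∀ {p} → 0# ≤ p → p ≤ 1# → ∀ {n} (g : LabelledGraph n) → 0# ≤ weight p g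
  weight-nonNeg 0≤p p≤1 []      = 0≤1
  weight-nonNeg 0≤p p≤1 (s ∷ g) = *-nonNeg (rowWeight-nonNeg 0≤p p≤1 s) (weight-nonNeg 0≤p p≤1 g)

  -- The parameters t and μ are exponential tilts of the vertex and the edge count.
  ℙ-sparse-subset-≤ : ∀ n k {p t T λ′ μ} {A : LabelledGraph n → Set} → 0# ≤ p → p ≤ 1# →
    0# ≤ t → 0# ≤ T → T * t ≈ 1# → 0# ≤ λ′ → 0# ≤ μ → μ ≤ 1# → λ′ * μ ≈ 1# →
    (∀ g → A g → ∃ λ W → ∣ W ∣ ≡ k × edges g W ℕ.≤ k) →
    ℙ n p A ≤ T ^ k * (1# + t) ^ n * (λ′ ^ k * (1# - p + p * μ) ^ tri k)
  ℙ-sparse-subset-≤ n k {p} {t} {T} {λ′} {μ} {A} 0≤p p≤1 0≤t 0≤T Tt≈1 0≤λ 0≤μ μ≤1 λμ≈1 sparse = begin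
    ℙ n p A
      ≤⟨ ∑-mono-≤ (allGraphs n) pointwise ⟩
    ∑ (allGraphs n) (λ g → ∑ (allSubsets n) (λ W → term g W))
      ≈⟨ ∑-comm (allGraphs n) (allSubsets n) term ⟩
    ∑ (allSubsets n) (λ W → ∑ (allGraphs n) (λ g → term g W))
      ≈⟨ ∑-cong (allSubsets n) (λ W → trans (∑-*ˡ (allGraphs n) _ _) (trans
           (*-congˡ (trans (∑-*ˡ (allGraphs n) _ _) (*-congˡ (graph-generating-function p μ W))))
           -- Where the indicator is nonzero, `∣ W ∣` is `k`, so the exponent `tri ∣ W ∣` becomes
           -- `tri k`.
           (𝟙-*-cong λ { ≡.refl → refl }))) ⟩
    ∑ (allSubsets n) (λ W → 𝟙 (∣ W ∣ ≡ k) * (λ′ ^ k * v ^ tri k))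
      ≈⟨ ∑-*ʳ (allSubsets n) _ _ ⟩
    ∑ (allSubsets n) (λ W → 𝟙 (∣ W ∣ ≡ k)) * (λ′ ^ k * v ^ tri k)
      ≤⟨ *-monoˡ-≤ (*-nonNeg (^-nonNeg 0≤λ k) (^-nonNeg 0≤v (tri k)))
                    (count-subsets-≤ n k 0≤t 0≤T Tt≈1) ⟩
    T ^ k * (1# + t) ^ n * (λ′ ^ k * v ^ tri k) ∎
    where
    open ≤-Reasoning
    v = 1# - p + p * μ
    0≤v = +-nonNeg (x≤y⇒0≤y-x p≤1) (*-nonNeg 0≤p 0≤μ)
    term : LabelledGraph n → Subset n → Carrier
    -- At a witness of the event the factor `λ′ ^ k * μ ^ edges g W` is at least 1, because
    -- `λ′ * μ ≈ 1`, `μ ≤ 1` and `edges g W ≤ k`. All other terms are nonnegative, so summing over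
    -- every `W` gives the union bound.
    term g W = 𝟙 (∣ W ∣ ≡ k) * (λ′ ^ k * (weight p g * μ ^ edges g W))
    0≤term : ∀ g W → 0# ≤ term g W
    0≤term g W = *-nonNeg (𝟙-nonNeg _) (*-nonNeg (^-nonNeg 0≤λ k)
      (*-nonNeg (weight-nonNeg 0≤p p≤1 g) (^-nonNeg 0≤μ (edges g W))))
    weight≤term : ∀ g W → ∣ W ∣ ≡ k → edges g W ℕ.≤ k → weight p g ≤ term g W
    weight≤term g W ∣W∣≡k e≤k = begin
      weight p g                                           ≈⟨ *-identityʳ _ ⟨
      weight p g * 1#                                      ≈⟨ *-congˡ (*≈1⇒^≈1 λμ≈1 k) ⟨
      weight p g * (λ′ ^ k * μ ^ k)                        ≤⟨ *-monoʳ-≤ (weight-nonNeg 0≤p p≤1 g)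
        (*-monoʳ-≤ (^-nonNeg 0≤λ k) (^-antimonoʳ-≤ 0≤μ μ≤1 e≤k)) ⟩
      weight p g * (λ′ ^ k * μ ^ edges g W)                ≈⟨ solve 3 (λ w l m →
        w :* (l :* m) := :1 :* (l :* (w :* m))) refl _ _ _ ⟩
      1# * (λ′ ^ k * (weight p g * μ ^ edges g W))         ≈⟨ *-congʳ (𝟙≈1 ∣W∣≡k) ⟨
      term g W                                             ∎
    pointwise : ∀ g → (if does (lem {A g}) then weight p g else 0#) ≤ ∑ (allSubsets n) (term g)
    pointwise g with lem {A g}
    ... | no  _ = ∑-nonNeg (allSubsets n) (0≤term g)
    ... | yes a with sparse g a
    ...   | W , ∣W∣≡k , e≤k = ≤-trans (weight≤term g W ∣W∣≡k e≤k) (∑-∈ (0≤term g) (∈-allSubsets W))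

-- Choice of the tilts and the numerical bound

module Threshold (lem : ExcludedMiddle 0ℓ) (ℝ : CompleteOrderedField) where

  open Logarithm lem ℝ public
  open Counting using (edges)
  open UnionBound lem ℝ using (tri; ℙ-sparse-subset-≤)
  open HopfPannwitz lem ℝ using (planar-diameterGraph-edges)

  half : Carrier
  half = fromℕ 2 ⁻¹

  0<fromℕ[1+n] : ∀ n → 0# < fromℕ (suc n)
  0<fromℕ[1+n] n = 1≤x⇒0<x (1≤fromℕ[1+n] n)

  2*half≈1 : fromℕ 2 * half ≈ 1#
  2*half≈1 = ⁻¹-inverseʳ (0<x⇒x≉0 (0<fromℕ[1+n] 1))

  0≤half : 0# ≤ half
  0≤half = ⁻¹-nonNeg (0<fromℕ[1+n] 1)

  x*half+x*half≈x : ∀ x → x * half + x * half ≈ x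
  x*half+x*half≈x x = trans
    (solve 2 (λ x h → x :* h :+ x :* h := x :* (:2 :* h)) refl x half)
    (trans (*-congˡ 2*half≈1) (*-identityʳ x))

  -- With h = x / 2, Bernoulli bounds (1 - h) ^ n below by 1 / 2, and (1 + h) (1 - h) ≤ 1.
  [1+x]^n≤4 : ∀ {x} n → 0# ≤ x → fromℕ n * x ≤ 1# → (1# + x) ^ n ≤ fromℕ 4
  [1+x]^n≤4 zero 0≤x nx≤1 = 1≤fromℕ[1+n] 3
  [1+x]^n≤4 {x} n@(suc m) 0≤x nx≤1 = begin
    (1# + x) ^ n                  ≤⟨ ^-mono-≤ (+-nonNeg 0≤1 0≤x) 1+x≤ n ⟩
    ((1# + h) * (1# + h)) ^ n     ≈⟨ ^-distrib-* (1# + h) (1# + h) n ⟩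
    y * y                         ≤⟨ *-mono-≤ 0≤y (fromℕ-nonNeg 2) y≤2 y≤2 ⟩
    fromℕ 2 * fromℕ 2             ≈⟨ ×1-homo-* 2 2 ⟨
    fromℕ 4                       ∎
    where
    open ≤-Reasoning
    h = x * half
    y = (1# + h) ^ n
    z = (1# - h) ^ n
    0≤h = *-nonNeg 0≤x 0≤half
    0≤1+h = +-nonNeg 0≤1 0≤h
    0≤y = ^-nonNeg 0≤1+h n
    1+x≤ : 1# + x ≤ (1# + h) * (1# + h)
    1+x≤ = begin
      1# + x              ≈⟨ +-congˡ (x*half+x*half≈x x) ⟨
      1# + (h + h)        ≤⟨ ≤-witness (0≤x² h) (solve 1 (λ h →
        (:1 :+ h) :* (:1 :+ h) :- (:1 :+ (h :+ h)) := h :* h) refl h) ⟩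
      (1# + h) * (1# + h) ∎
    h≤1 : h ≤ 1#
    h≤1 = begin
      h                ≤⟨ x≤x+y 0≤h ⟩
      h + h            ≈⟨ x*half+x*half≈x x ⟩
      x                ≈⟨ *-identityˡ x ⟨
      1# * x           ≤⟨ *-monoˡ-≤ 0≤x (1≤fromℕ[1+n] m) ⟩
      fromℕ n * x      ≤⟨ nx≤1 ⟩
      1#               ∎
    yz≤1 : y * z ≤ 1#
    yz≤1 = begin
      y * z                         ≈⟨ ^-distrib-* (1# + h) (1# - h) n ⟨
      ((1# + h) * (1# - h)) ^ n     ≤⟨ x^n≤1 (*-nonNeg 0≤1+h (x≤y⇒0≤y-x h≤1)) (≤-witness (0≤x² h)
        (solve 1 (λ h → :1 :- (:1 :+ h) :* (:1 :- h) := h :* h) refl h)) n ⟩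
      1#                            ∎
    1≤2z : 1# ≤ fromℕ 2 * z
    1≤2z = begin
      1#                                    ≤⟨ ≤-witness (x≤y⇒0≤y-x nx≤1) (begin-equality
        fromℕ 2 * (1# + fromℕ n * - h) - 1#      ≈⟨ solve 2 (λ m h →
          :2 :* (:1 :+ m :* (:- h)) :- :1 := :1 :- m :* (h :+ h)) refl (fromℕ n) h ⟩
        1# - fromℕ n * (h + h)                   ≈⟨ +-congˡ (-‿cong (*-congˡ (x*half+x*half≈x x))) ⟩
        1# - fromℕ n * x                         ∎) ⟩
      fromℕ 2 * (1# + fromℕ n * - h)        ≤⟨ *-monoʳ-≤ (fromℕ-nonNeg 2) (bernoulli (x≤y⇒0≤y-x h≤1) n) ⟩
      fromℕ 2 * z                           ∎
    y≤2 : y ≤ fromℕ 2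
    y≤2 = begin
      y                    ≈⟨ *-identityʳ y ⟨
      y * 1#               ≤⟨ *-monoʳ-≤ 0≤y 1≤2z ⟩
      y * (fromℕ 2 * z)    ≈⟨ solve 3 (λ a b c → a :* (b :* c) := b :* (a :* c)) refl y (fromℕ 2) z ⟩
      fromℕ 2 * (y * z)    ≤⟨ *-monoʳ-≤ (fromℕ-nonNeg 2) yz≤1 ⟩
      fromℕ 2 * 1#         ≈⟨ *-identityʳ _ ⟩
      fromℕ 2              ∎

  [1+n⁻¹]^n≤4 : ∀ m → (1# + fromℕ (suc m) ⁻¹) ^ suc m ≤ fromℕ 4
  [1+n⁻¹]^n≤4 m = [1+x]^n≤4 (suc m) (⁻¹-nonNeg (0<fromℕ[1+n] m))
    (≤-reflexive (⁻¹-inverseʳ (0<x⇒x≉0 (0<fromℕ[1+n] m))))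

  -- Bernoulli replaces `1 + k / n` by `(1 + 1 / n) ^ k`; then the exponents `k` and `n` are
  -- swapped.
  [1+k/n]^n≤4^k : ∀ m k → (1# + fromℕ k * fromℕ (suc m) ⁻¹) ^ suc m ≤ fromℕ 4 ^ k
  [1+k/n]^n≤4^k m k = begin
    (1# + fromℕ k * x) ^ suc m    ≤⟨ ^-mono-≤ (+-nonNeg 0≤1 (*-nonNeg (fromℕ-nonNeg k) 0≤x))
                                               (bernoulli 0≤1+x k) (suc m) ⟩
    ((1# + x) ^ k) ^ suc m        ≈⟨ ^-assocʳ (1# + x) k (suc m) ⟩
    (1# + x) ^ (k ℕ.* suc m)      ≡⟨ ≡.cong ((1# + x) ^_) (ℕ.*-comm k (suc m)) ⟩
    (1# + x) ^ (suc m ℕ.* k)      ≈⟨ ^-assocʳ (1# + x) (suc m) k ⟨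
    ((1# + x) ^ suc m) ^ k        ≤⟨ ^-mono-≤ (^-nonNeg 0≤1+x (suc m)) ([1+n⁻¹]^n≤4 m) k ⟩
    fromℕ 4 ^ k                   ∎
    where
    open ≤-Reasoning
    x = fromℕ (suc m) ⁻¹
    0≤x = ⁻¹-nonNeg (0<fromℕ[1+n] m)
    0≤1+x = +-nonNeg 0≤1 0≤x

  -- The doubled form avoids halving an exponent; it is what the square of `V` needs.
  tri+tri : ∀ j → tri (suc j) ℕ.+ tri (suc j) ≡ j ℕ.* suc j
  tri+tri zero    = ≡.refl
  tri+tri (suc j) = ≡.trans
    (ℕ-solve 2 (λ j t → (con′ 1 :+′ j :+′ t) :+′ (con′ 1 :+′ j :+′ t)
      :=′ con′ 2 :+′ j :+′ j :+′ (t :+′ t)) ≡.refl j (tri (suc j)))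
    (≡.trans (≡.cong (2 ℕ.+ j ℕ.+ j ℕ.+_) (tri+tri j))
      (ℕ-solve 1 (λ j → con′ 2 :+′ j :+′ j :+′ j :*′ (con′ 1 :+′ j)
        :=′ (con′ 1 :+′ j) :*′ (con′ 2 :+′ j)) ≡.refl j))

  -- The union bound at t = k / n and λ = k p / q, writing b = 1 / q.
  ℙ-sparse-subset≤half : ∀ n j {p b} {A : LabelledGraph n → Set} →
    let N = fromℕ n ; k = suc j ; K = fromℕ k ; X = N * p ; q = 1# - p in
    1# ≤ N → 0# < p → 0# < q → q * b ≈ 1# → 0# < b → q ≤ K * p →
    fromℕ 2 ^ 8 * (X * X) * b ^ 3 ≤ b ^ k →
    (∀ g → A g → ∃ λ W → ∣ W ∣ ≡ k × edges g W ℕ.≤ k) →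
    ℙ n p A ≤ half
  ℙ-sparse-subset≤half zero _ 1≤0 = ⊥-elim (<⇒≱ 0<1 1≤0)
  ℙ-sparse-subset≤half n@(suc m) j {p} {b} {A}
    _ 0<p@(0≤p , _) 0<q@(0≤q , _) qb≈1 0<b@(0≤b , _) q≤Kp large sparse =
    ≤-trans (ℙ-sparse-subset-≤ n k 0≤p p≤1 0≤t 0≤T Tt≈1 0≤λ 0≤μ μ≤1 λμ≈1 sparse) B≤half
    where
    open ≤-Reasoning
    k = suc j
    N = fromℕ n
    K = fromℕ k
    X = N * p
    q = 1# - p
    0<N = 0<fromℕ[1+n] m
    0<K = 0<fromℕ[1+n] j
    NN⁻¹≈1 = ⁻¹-inverseʳ (0<x⇒x≉0 0<N)
    KK⁻¹≈1 = ⁻¹-inverseʳ (0<x⇒x≉0 0<K)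
    pp⁻¹≈1 = ⁻¹-inverseʳ (0<x⇒x≉0 0<p)
    0≤K⁻¹ = ⁻¹-nonNeg 0<K
    p≤1 = 0≤y-x⇒x≤y 0≤q
    t = K * N ⁻¹
    T = N * K ⁻¹
    λ′ = K * p * b
    μ = K ⁻¹ * p ⁻¹ * q
    0≤t = *-nonNeg (proj₁ 0<K) (⁻¹-nonNeg 0<N)
    0≤T = *-nonNeg (proj₁ 0<N) 0≤K⁻¹
    0≤λ = *-nonNeg (*-nonNeg (proj₁ 0<K) 0≤p) 0≤b
    0≤μ = *-nonNeg (*-nonNeg 0≤K⁻¹ (⁻¹-nonNeg 0<p)) 0≤q
    Tt≈1 : T * t ≈ 1#
    Tt≈1 = begin-equality
      N * K ⁻¹ * (K * N ⁻¹)      ≈⟨ solve 4 (λ a b c d → a :* b :* (c :* d) := a :* d :* (c :* b)) refl _ _ _ _ ⟩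
      N * N ⁻¹ * (K * K ⁻¹)      ≈⟨ *-cong NN⁻¹≈1 KK⁻¹≈1 ⟩
      1# * 1#                    ≈⟨ *-identityʳ 1# ⟩
      1#                         ∎
    λμ≈1 : λ′ * μ ≈ 1#
    λμ≈1 = begin-equality
      K * p * b * (K ⁻¹ * p ⁻¹ * q)            ≈⟨ solve 6 (λ a b c d e f →
        a :* b :* c :* (d :* e :* f) := a :* d :* (b :* e) :* (f :* c)) refl _ _ _ _ _ _ ⟩
      K * K ⁻¹ * (p * p ⁻¹) * (q * b)          ≈⟨ *-cong (*-cong KK⁻¹≈1 pp⁻¹≈1) qb≈1 ⟩
      1# * 1# * 1#                             ≈⟨ solve 0 (:1 :* :1 :* :1 := :1) refl ⟩
      1#                                       ∎
    -- The event bounds the edge count from above, so the tilt has to favour few edges; `q≤Kp` is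
    -- exactly this condition.
    1≤λ : 1# ≤ λ′
    1≤λ = ≤-respˡ-≈ qb≈1 (*-monoˡ-≤ 0≤b q≤Kp)
    μ≤1 : μ ≤ 1#
    μ≤1 = begin
      μ           ≈⟨ *-identityˡ μ ⟨
      1# * μ      ≤⟨ *-monoˡ-≤ 0≤μ 1≤λ ⟩
      λ′ * μ      ≈⟨ λμ≈1 ⟩
      1#          ∎
    v = q + p * μ
    0≤v = +-nonNeg 0≤q (*-nonNeg 0≤p 0≤μ)
    -- With this `λ′` a pair costs `q` up to the factor `1 + 1 / K`, whose j-th power is at most 4.
    v≈ : v ≈ q * (1# + K ⁻¹)
    v≈ = begin-equality
      q + p * (K ⁻¹ * p ⁻¹ * q)      ≈⟨ solve 4 (λ q p k p′ →
        q :+ p :* (k :* p′ :* q) := q :+ p :* p′ :* (q :* k)) refl _ _ _ _ ⟩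
      q + p * p ⁻¹ * (q * K ⁻¹)      ≈⟨ +-congˡ (*-congʳ pp⁻¹≈1) ⟩
      q + 1# * (q * K ⁻¹)            ≈⟨ solve 2 (λ q k → q :+ :1 :* (q :* k) := q :* (:1 :+ k)) refl _ _ ⟩
      q * (1# + K ⁻¹)                ∎
    v^j≤ : v ^ j ≤ q ^ j * fromℕ 4
    v^j≤ = begin
      v ^ j                          ≈⟨ ^-congˡ j v≈ ⟩
      (q * (1# + K ⁻¹)) ^ j          ≈⟨ ^-distrib-* q (1# + K ⁻¹) j ⟩
      q ^ j * (1# + K ⁻¹) ^ j        ≤⟨ *-monoʳ-≤ (^-nonNeg 0≤q j)
        (x≤y*x (^-nonNeg (+-nonNeg 0≤1 0≤K⁻¹) j) (x≤x+y 0≤K⁻¹)) ⟩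
      q ^ j * (1# + K ⁻¹) ^ k        ≤⟨ *-monoʳ-≤ (^-nonNeg 0≤q j) ([1+n⁻¹]^n≤4 j) ⟩
      q ^ j * fromℕ 4                ∎
      where
      x≤y*x : ∀ {x y} → 0# ≤ x → 1# ≤ y → x ≤ y * x
      x≤y*x 0≤x 1≤y = ≤-respʳ-≈ (*-comm _ _) (x≤x*y 0≤x 1≤y)
    V = v ^ tri k
    V²≤ : V * V ≤ (q ^ j * fromℕ 4) ^ k
    V²≤ = begin
      V * V                          ≈⟨ ^-homo-* v (tri k) (tri k) ⟨
      v ^ (tri k ℕ.+ tri k)          ≡⟨ ≡.cong (v ^_) (tri+tri j) ⟩
      v ^ (j ℕ.* k)                  ≈⟨ ^-assocʳ v j k ⟨
      (v ^ j) ^ k                    ≤⟨ ^-mono-≤ (^-nonNeg 0≤v j) v^j≤ k ⟩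
      (q ^ j * fromℕ 4) ^ k          ∎
    S = (1# + t) ^ n
    0≤S = ^-nonNeg (+-nonNeg 0≤1 0≤t) n
    B = T ^ k * S * (λ′ ^ k * V)
    a = T * λ′
    a≈Xb : a ≈ X * b
    a≈Xb = begin-equality
      N * K ⁻¹ * (K * p * b)         ≈⟨ solve 5 (λ n k′ k p b →
        n :* k′ :* (k :* p :* b) := k :* k′ :* (n :* p :* b)) refl _ _ _ _ _ ⟩
      K * K ⁻¹ * (X * b)             ≈⟨ *-congʳ KK⁻¹≈1 ⟩
      1# * (X * b)                   ≈⟨ *-identityˡ _ ⟩
      X * b                          ∎
    f = fromℕ 4
    0≤f = fromℕ-nonNeg 4
    -- Since `a ≈ X * b` and `q ^ j` is `b * q ^ k`, this is the base 64 X² b³ / b^k of the squared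
    -- bound.
    C = a * a * (f * f) * (q ^ j * f)
    0≤C : 0# ≤ C
    0≤C = *-nonNeg (*-nonNeg (0≤x² a) (0≤x² f)) (*-nonNeg (^-nonNeg 0≤q j) 0≤f)
    B²≤C^k : B * B ≤ C ^ k
    B²≤C^k = begin
      B * B                                        ≈⟨ solve 4 (λ t s l v →
        t :* s :* (l :* v) :* (t :* s :* (l :* v)) := t :* l :* (t :* l) :* (s :* s) :* (v :* v)) refl _ _ _ _ ⟩
      T ^ k * λ′ ^ k * (T ^ k * λ′ ^ k) * (S * S) * (V * V)   ≈⟨ *-congʳ (*-congʳ (trans
        (*-cong (sym (^-distrib-* T λ′ k)) (sym (^-distrib-* T λ′ k))) (sym (^-distrib-* a a k)))) ⟩
      (a * a) ^ k * (S * S) * (V * V)              ≤⟨ *-mono-≤ (0≤x² V)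
        (*-nonNeg 0≤a²^k (0≤x² (f ^ k)))
        (*-monoʳ-≤ 0≤a²^k (*-mono-≤ 0≤S (^-nonNeg 0≤f k) ([1+k/n]^n≤4^k m k) ([1+k/n]^n≤4^k m k)))
        V²≤ ⟩
      (a * a) ^ k * (f ^ k * f ^ k) * (q ^ j * f) ^ k     ≈⟨ *-congʳ (trans
        (^-distrib-* (a * a) (f * f) k) (*-congˡ (^-distrib-* f f k))) ⟨
      (a * a * (f * f)) ^ k * (q ^ j * f) ^ k      ≈⟨ ^-distrib-* _ _ k ⟨
      C ^ k                                        ∎
      where
      0≤a²^k = ^-nonNeg (0≤x² a) k
    -- Multiplying by `q * b ≈ 1#` completes `q ^ j` to `q ^ k` and supplies the third `b`. The four
    -- factors 4 make up `fromℕ 2 ^ 8`.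
    4C≤1 : f * C ≤ 1#
    4C≤1 = begin
      f * C                                                ≈⟨ *-congˡ (*-congʳ (*-congʳ (*-cong a≈Xb a≈Xb))) ⟩
      f * (X * b * (X * b) * (f * f) * (q ^ j * f))        ≈⟨ *-identityˡ _ ⟨
      1# * (f * (X * b * (X * b) * (f * f) * (q ^ j * f))) ≈⟨ *-congʳ qb≈1 ⟨
      q * b * (f * (X * b * (X * b) * (f * f) * (q ^ j * f)))   ≈⟨ solve 4 (λ q b x r →
        q :* b :* (:4 :* (x :* b :* (x :* b) :* (:4 :* :4) :* (r :* :4)))
        := :2 :^ 8 :* (x :* x) :* b :^ 3 :* (q :* r)) refl _ _ _ _ ⟩
      fromℕ 2 ^ 8 * (X * X) * b ^ 3 * q ^ k                ≤⟨ *-monoˡ-≤ (^-nonNeg 0≤q k) large ⟩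
      b ^ k * q ^ k                                        ≈⟨ ^-distrib-* b q k ⟨
      (b * q) ^ k                                          ≈⟨ ^-congˡ k (trans (*-comm b q) qb≈1) ⟩
      1# ^ k                                               ≈⟨ 1^n≈1 k ⟩
      1#                                                   ∎
    C≤1 : C ≤ 1#
    C≤1 = begin
      C          ≈⟨ *-identityˡ C ⟨
      1# * C     ≤⟨ *-monoˡ-≤ 0≤C (1≤fromℕ[1+n] 3) ⟩
      f * C      ≤⟨ 4C≤1 ⟩
      1#         ∎
    B≤half : B ≤ half
    B≤half = *-cancelˡ-≤ (0<fromℕ[1+n] 1) (≤-respʳ-≈ (sym 2*half≈1) (square-cancel-≤ 0≤1 (begin
      fromℕ 2 * B * (fromℕ 2 * B)     ≈⟨ solve 1 (λ b → :2 :* b :* (:2 :* b) := :4 :* (b :* b)) refl B ⟩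
      f * (B * B)                     ≤⟨ *-monoʳ-≤ 0≤f B²≤C^k ⟩
      -- As `k` is a successor, one factor `C` is always present, and it alone absorbs the 4.
      f * (C * C ^ j)                 ≤⟨ *-monoʳ-≤ 0≤f (*-monoʳ-≤ 0≤C (x^n≤1 0≤C C≤1 j)) ⟩
      f * (C * 1#)                    ≈⟨ *-congˡ (*-identityʳ C) ⟩
      f * C                           ≤⟨ 4C≤1 ⟩
      1#                              ≈⟨ *-identityʳ 1# ⟨
      1# * 1#                         ∎)))

  -- Logarithmic estimates at the threshold

  ln2≤1 : ln (fromℕ 2) ≤ 1#
  ln2≤1 = ≤-trans (ln-≤ (1≤fromℕ[1+n] 1)) (≤-reflexive (solve 0 (:2 :- :1 := :1) refl))

  half≤ln2 : half ≤ ln (fromℕ 2)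
  half≤ln2 = ≤-trans (≤-reflexive (solve 1 (λ h → h := (:2 :- :1) :* h) refl half))
    (ln-≥ (1≤fromℕ[1+n] 1))

  -- The witness is a power of two, since `ln` of the j-th power is at least j/2.
  ln-unbounded : ∀ R → ∃ λ M → 1# ≤ M × R ≤ ln M
  ln-unbounded R with archimedean (fromℕ 2 * R)
  ... | j , 2R≤j = fromℕ 2 ^ j , 1≤x^n (1≤fromℕ[1+n] 1) j , (begin
    R                         ≈⟨ *-identityˡ R ⟨
    1# * R                    ≈⟨ *-congʳ 2*half≈1 ⟨
    fromℕ 2 * half * R        ≈⟨ solve 3 (λ t h r → t :* h :* r := t :* r :* h) refl (fromℕ 2) half R ⟩
    fromℕ 2 * R * half        ≤⟨ *-monoˡ-≤ 0≤half 2R≤j ⟩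
    fromℕ j * half            ≤⟨ *-monoʳ-≤ (fromℕ-nonNeg j) half≤ln2 ⟩
    fromℕ j * ln (fromℕ 2)    ≤⟨ ln-^-≥ (1≤fromℕ[1+n] 1) j ⟩
    ln (fromℕ 2 ^ j)          ∎)
    where open ≤-Reasoning

  -- Argued by contraposition, since `ln` is known to be monotone and no exponential is at hand to
  -- invert it. The term `small` absorbs the constant and the factor `b ^ 3`.
  large-power : ∀ {X b ε} k → 1# ≤ X → 1# ≤ b →
    fromℕ 3 * ln b + fromℕ 8 * ln (fromℕ 2) ≤ ε * ln X →
    (fromℕ 2 + ε) * ln X < fromℕ k * ln b →
    fromℕ 2 ^ 8 * (X * X) * b ^ 3 ≤ b ^ k
  large-power {X} {b} {ε} k 1≤X 1≤b small exceeds = ≮⇒≥ λ { (b^k≤ , _) → <⇒≱ exceeds (begin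
    fromℕ k * ln b                                                       ≤⟨ ln-^-≥ 1≤b k ⟩
    ln (b ^ k)                                                           ≤⟨ ln-mono-≤ (1≤x^n 1≤b k) b^k≤ ⟩
    ln (fromℕ 2 ^ 8 * (X * X) * b ^ 3)                                   ≤⟨ ln-*-≤ (1≤x*y 1≤2^8 1≤X²) (1≤x^n 1≤b 3) ⟩
    ln (fromℕ 2 ^ 8 * (X * X)) + ln (b ^ 3)                              ≤⟨ +-mono-≤ (ln-*-≤ 1≤2^8 1≤X²) (ln-^-≤ 1≤b 3) ⟩
    ln (fromℕ 2 ^ 8) + ln (X * X) + fromℕ 3 * ln b                       ≤⟨ +-monoˡ-≤ _
      (+-mono-≤ (ln-^-≤ (1≤fromℕ[1+n] 1) 8) (ln-*-≤ 1≤X 1≤X)) ⟩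
    fromℕ 8 * ln (fromℕ 2) + (ln X + ln X) + fromℕ 3 * ln b              ≈⟨ solve 3 (λ e x l →
      e :+ (x :+ x) :+ l := :2 :* x :+ (l :+ e)) refl _ _ _ ⟩
    fromℕ 2 * ln X + (fromℕ 3 * ln b + fromℕ 8 * ln (fromℕ 2))           ≤⟨ +-monoʳ-≤ _ small ⟩
    fromℕ 2 * ln X + ε * ln X                                            ≈⟨ distribʳ _ _ _ ⟨
    (fromℕ 2 + ε) * ln X                                                 ∎) }
    where
    open ≤-Reasoning
    1≤X² = 1≤x*y 1≤X 1≤X
    1≤2^8 = 1≤x^n (1≤fromℕ[1+n] 1) 8

  -- For q ≥ 1/2 we have b ≤ 2, and for p ≥ 1/2 we have ln b ≤ b ≤ ln N / M with N ≤ 2 X.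
  M*lnb≤ : ∀ {N p b M} → let q = 1# - p ; X = N * p in
    1# ≤ N → 1# ≤ X → 0# < q → q * b ≈ 1# → 1# ≤ b → 0# ≤ M → 1# ≤ M → M ≤ q * ln N →
    M * ln b ≤ M * ln (fromℕ 2) + ln X
  M*lnb≤ {N} {p} {b} {M} 1≤N 1≤X (0≤q , _) qb≈1 1≤b 0≤M 1≤M M≤qlnN with ≤-total p (1# - p)
  ... | inj₁ p≤q = ≤-trans (*-monoʳ-≤ 0≤M (ln-mono-≤ 1≤b b≤2)) (x≤x+y (ln-nonNeg 1≤X))
    where
    open ≤-Reasoning
    q = 1# - p
    0≤b = proj₁ (1≤x⇒0<x 1≤b)
    b≤2 : b ≤ fromℕ 2
    b≤2 = begin
      b                  ≈⟨ solve 2 (λ p b → b := (p :+ (:1 :- p)) :* b) refl p b ⟩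
      (p + q) * b        ≤⟨ *-monoˡ-≤ 0≤b (+-monoˡ-≤ q p≤q) ⟩
      (q + q) * b        ≈⟨ solve 2 (λ q b → (q :+ q) :* b := :2 :* (q :* b)) refl q b ⟩
      fromℕ 2 * (q * b)  ≈⟨ *-congˡ qb≈1 ⟩
      fromℕ 2 * 1#       ≈⟨ *-identityʳ _ ⟩
      fromℕ 2            ∎
  ... | inj₂ q≤p = begin
    M * ln b                       ≤⟨ *-monoʳ-≤ 0≤M (≤-trans (ln-≤ 1≤b) (x-y≤x 0≤1)) ⟩
    M * b                          ≤⟨ *-monoˡ-≤ 0≤b M≤qlnN ⟩
    q * ln N * b                   ≈⟨ solve 3 (λ q l b → q :* l :* b := q :* b :* l) refl _ _ _ ⟩
    q * b * ln N                   ≈⟨ *-congʳ qb≈1 ⟩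
    1# * ln N                      ≈⟨ *-identityˡ _ ⟩
    ln N                           ≤⟨ ln-mono-≤ 1≤N N≤2X ⟩
    ln (fromℕ 2 * X)               ≤⟨ ln-*-≤ (1≤fromℕ[1+n] 1) 1≤X ⟩
    ln (fromℕ 2) + ln X            ≤⟨ +-monoˡ-≤ _
      (≤-respˡ-≈ (*-identityˡ _) (*-monoˡ-≤ (ln-nonNeg (1≤fromℕ[1+n] 1)) 1≤M)) ⟩
    M * ln (fromℕ 2) + ln X        ∎
    where
    open ≤-Reasoning
    q = 1# - p
    X = N * p
    0≤b = proj₁ (1≤x⇒0<x 1≤b)
    N≤2X : N ≤ fromℕ 2 * X
    N≤2X = begin
      N                      ≈⟨ solve 2 (λ n p → n := n :* (p :+ (:1 :- p))) refl N p ⟩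
      N * (p + q)            ≤⟨ *-monoʳ-≤ (proj₁ (1≤x⇒0<x 1≤N)) (+-monoʳ-≤ p q≤p) ⟩
      N * (p + p)            ≈⟨ solve 2 (λ n p → n :* (p :+ p) := :2 :* (n :* p)) refl N p ⟩
      fromℕ 2 * X            ∎

  -- After doubling, one share of `ε * ln X` comes from `6 ln b ≤ ε * M * ln b`, and the other pays
  -- for the constants. The 22 is 16 from the doubled 8, plus 6 from `ε * M`; the extra `ε` comes
  -- from the `+ 1#` in the choice of `M`.
  small-logs : ∀ {X b ε M} → 0# < ε → 1# ≤ b → ε * M ≈ fromℕ 6 + ε →
    fromℕ 22 + ε ≤ ε * ln X → M * ln b ≤ M * ln (fromℕ 2) + ln X →
    fromℕ 3 * ln b + fromℕ 8 * ln (fromℕ 2) ≤ ε * ln X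
  small-logs {X} {b} {ε} {M} 0<ε@(0≤ε , _) 1≤b εM≈ large Mlnb≤ = *-cancelˡ-≤ (0<fromℕ[1+n] 1) (begin
    fromℕ 2 * (fromℕ 3 * ln b + fromℕ 8 * l)          ≈⟨ solve 3 (λ s t l →
        :2 :* (s :* t :+ l) := :2 :* s :* t :+ :2 :* l) refl _ _ _ ⟩
    fromℕ 2 * fromℕ 3 * ln b + fromℕ 2 * (fromℕ 8 * l) ≈⟨ +-cong (*-congʳ (sym (×1-homo-* 2 3)))
        (trans (sym (*-assoc _ _ _)) (*-congʳ (sym (×1-homo-* 2 8)))) ⟩
    fromℕ 6 * ln b + fromℕ 16 * l                     ≤⟨ +-monoˡ-≤ _ (*-monoˡ-≤ (ln-nonNeg 1≤b) (x≤x+y 0≤ε)) ⟩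
    (fromℕ 6 + ε) * ln b + fromℕ 16 * l               ≈⟨ +-congʳ (*-congʳ εM≈) ⟨
    ε * M * ln b + fromℕ 16 * l                       ≈⟨ +-congʳ (*-assoc _ _ _) ⟩
    ε * (M * ln b) + fromℕ 16 * l                     ≤⟨ +-monoˡ-≤ _ (*-monoʳ-≤ 0≤ε Mlnb≤) ⟩
    ε * (M * l + ln X) + fromℕ 16 * l                 ≈⟨ solve 5 (λ e m l x s →
        e :* (m :* l :+ x) :+ s :* l := (s :+ e :* m) :* l :+ e :* x) refl _ _ _ _ _ ⟩
    (fromℕ 16 + ε * M) * l + ε * ln X                 ≈⟨ +-congʳ (*-congʳ (trans (+-congˡ εM≈)
      (trans (sym (+-assoc _ _ _)) (+-congʳ (sym (×-homo-+ 1# 16 6)))))) ⟩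
    (fromℕ 22 + ε) * l + ε * ln X                     ≤⟨ +-monoˡ-≤ _ (*-monoʳ-≤ (+-nonNeg (fromℕ-nonNeg 22) 0≤ε) ln2≤1) ⟩
    (fromℕ 22 + ε) * 1# + ε * ln X                    ≤⟨ +-monoˡ-≤ _ (≤-respˡ-≈ (sym (*-identityʳ _)) large) ⟩
    ε * ln X + ε * ln X                               ≈⟨ solve 1 (λ x → x :+ x := :2 :* x) refl _ ⟩
    fromℕ 2 * (ε * ln X)                              ∎)
    where
    open ≤-Reasoning
    l = ln (fromℕ 2)

  -- The hypothesis `0# ≤ x` covers the value 0, which `largest` returns when no size qualifies.
  largest-≤ : ∀ {Q : ℕ → Set} {x} m → 0# ≤ x → (∀ j → Q (suc j) → fromℕ (suc j) ≤ x) →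
    fromℕ (largest Q m) ≤ x
  largest-≤         zero    0≤x Q⇒≤ = 0≤x
  largest-≤ {Q} {x} (suc m) 0≤x Q⇒≤ with lem {Q (suc m)}
  ... | yes q = Q⇒≤ m q
  ... | no  _ = largest-≤ m 0≤x Q⇒≤

  -- Both bounds at a fixed n

  module _ {ε} (0<ε : 0# < ε) (n : ℕ) (p M : Carrier) (0≤p : 0# ≤ p) (p≤1 : p ≤ 1#)
    (1≤M : 1# ≤ M) (εM≈ : ε * M ≈ fromℕ 6 + ε) (1≤X : 1# ≤ fromℕ n * p)
    (1≤lnX : 1# ≤ ln (fromℕ n * p)) (large : fromℕ 22 + ε ≤ ε * ln (fromℕ n * p))
    (M≤qlnN : M ≤ (1# - p) * ln (fromℕ n)) where

    N X q b bound : Carrier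
    N = fromℕ n
    X = N * p
    q = 1# - p
    b = q ⁻¹
    bound = (fromℕ 2 + ε) * log b X

    0≤ε = proj₁ 0<ε

    0<p : 0# < p
    0<p = 0≤p , λ 0≈p → <⇒≱ 0<1 (≤-respʳ-≈ (trans (*-congˡ (sym 0≈p)) (zeroʳ N)) 1≤X)

    1≤N : 1# ≤ N
    1≤N = ≤-trans 1≤X (≤-respʳ-≈ (*-identityʳ N) (*-monoʳ-≤ (fromℕ-nonNeg n) p≤1))

    0<q : 0# < q
    0<q = x≤y⇒0≤y-x p≤1 , λ 0≈q → <⇒≱ 0<1
      (≤-trans 1≤M (≤-respʳ-≈ (trans (*-congʳ (sym 0≈q)) (zeroˡ _)) M≤qlnN))

    0<b = ⁻¹-pos 0<q
    0≤b = proj₁ 0<b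

    qb≈1 : q * b ≈ 1#
    qb≈1 = ⁻¹-inverseʳ (0<x⇒x≉0 0<q)

    b-1≈pb : b - 1# ≈ p * b
    b-1≈pb = trans (+-congˡ (-‿cong (sym qb≈1)))
      (solve 2 (λ p b → b :- (:1 :- p) :* b := p :* b) refl p b)

    -- Strictness makes `ln b` positive, so that `log b X` is a genuine quotient.
    1<b : 1# < b
    1<b = 0<y-x⇒x<y (<-≤-trans (*-pos 0<p 0<b) (≤-reflexive (sym b-1≈pb)))

    1≤b = proj₁ 1<b
    0<lnb = ln-pos 1<b

    0≤bound : 0# ≤ bound
    0≤bound = *-nonNeg (+-nonNeg (fromℕ-nonNeg 2) 0≤ε)
      (*-nonNeg (ln-nonNeg 1≤X) (⁻¹-nonNeg 0<lnb))

    likely⇒≤bound : ∀ j {A : LabelledGraph n → Set} →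
      (∀ g → A g → ∃ λ W → ∣ W ∣ ≡ suc j × edges g W ℕ.≤ suc j) →
      Likely n p A → fromℕ (suc j) ≤ bound
    likely⇒≤bound j sparse likely with ≤-or-> (fromℕ (suc j) * ln b) ((fromℕ 2 + ε) * ln X)
    ... | inj₁ K*lnb≤ = begin
      K                                   ≈⟨ *-identityʳ K ⟨
      K * 1#                              ≈⟨ *-congˡ (⁻¹-inverseʳ (0<x⇒x≉0 0<lnb)) ⟨
      K * (ln b * ln b ⁻¹)                ≈⟨ *-assoc _ _ _ ⟨
      K * ln b * ln b ⁻¹                  ≤⟨ *-monoˡ-≤ (⁻¹-nonNeg 0<lnb) K*lnb≤ ⟩
      (fromℕ 2 + ε) * ln X * ln b ⁻¹      ≈⟨ *-assoc _ _ _ ⟩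
      bound                               ∎
      where
      open ≤-Reasoning
      K = fromℕ (suc j)
    ... | inj₂ exceeds = ⊥-elim (<⇒≱ likely
      (ℙ-sparse-subset≤half n j 1≤N 0<p 0<q qb≈1 0<b q≤Kp big sparse))
      where
      open ≤-Reasoning
      K = fromℕ (suc j)
      -- A size beyond the bound has `K * ln b` at least 1, and `ln b ≤ b - 1 = p b` turns this into
      -- the condition on the edge tilt.
      q≤Kp : q ≤ K * p
      q≤Kp = begin
        q                              ≈⟨ *-identityʳ q ⟨
        q * 1#                         ≤⟨ *-monoʳ-≤ (proj₁ 0<q) (begin
          1#                              ≤⟨ 1≤lnX ⟩
          ln X                            ≈⟨ *-identityˡ _ ⟨
          1# * ln X                       ≤⟨ *-monoˡ-≤ (ln-nonNeg 1≤X) (≤-trans (1≤fromℕ[1+n] 1) (x≤x+y 0≤ε)) ⟩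
          (fromℕ 2 + ε) * ln X            ≤⟨ proj₁ exceeds ⟩
          K * ln b                        ≤⟨ *-monoʳ-≤ (fromℕ-nonNeg (suc j)) (ln-≤ 1≤b) ⟩
          K * (b - 1#)                    ≈⟨ *-congˡ b-1≈pb ⟩
          K * (p * b)                     ∎) ⟩
        q * (K * (p * b))              ≈⟨ solve 4 (λ q k p b → q :* (k :* (p :* b)) := q :* b :* (k :* p)) refl _ _ _ _ ⟩
        q * b * (K * p)                ≈⟨ *-congʳ qb≈1 ⟩
        1# * (K * p)                   ≈⟨ *-identityˡ _ ⟩
        K * p                          ∎
      big : fromℕ 2 ^ 8 * (X * X) * b ^ 3 ≤ b ^ suc j
      big = large-power (suc j) 1≤X 1≤b
        (small-logs 0<ε 1≤b εM≈ large (M*lnb≤ 1≤N 1≤X 0<q qb≈1 1≤b (≤-trans 0≤1 1≤M) 1≤M M≤qlnN))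
        exceeds

    sparse : ∀ {k} (g : LabelledGraph n) (W : Subset n) → ∣ W ∣ ≡ k →
      IsDiameterGraph 2 (induced g W) → ∃ λ W → ∣ W ∣ ≡ k × edges g W ℕ.≤ k
    sparse g W ∣W∣≡k diam =
      W , ∣W∣≡k , ℕ.≤-trans (planar-diameterGraph-edges g W diam) (ℕ.≤-reflexive ∣W∣≡k)

    u-≤ : fromℕ (u 2 n p) ≤ bound
    u-≤ = largest-≤ n 0≤bound λ j → likely⇒≤bound j
      λ { g (W , ∣W∣≡k , diam , _) → sparse g W ∣W∣≡k diam }

    u′-≤ : fromℕ (u′ 2 n p) ≤ bound
    u′-≤ = largest-≤ n 0≤bound λ j → likely⇒≤bound j
      λ { g (W , ∣W∣≡k , diam , _) → sparse g W ∣W∣≡k diam }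

theorem16 : (lem : ExcludedMiddle 0ℓ) (ℝ : CompleteOrderedField) →
    let open Theory lem ℝ in
    (p : ℕ → Carrier) → (∀ n → 0# ≤ p n × p n ≤ 1#) →
    Tends∞ (λ n → p n * fromℕ n) →
    Tends∞ (λ n → (1# - p n) * ln (fromℕ n)) →
    ∀ ε → 0# < ε → ∃ λ n₀ → ∀ n → n₀ ℕ.≤ n →
    (fromℕ (u 2 n (p n)) ≤ (fromℕ 2 + ε) * log ((1# - p n) ⁻¹) (fromℕ n * p n)) ×
    (fromℕ (u′ 2 n (p n)) ≤ (fromℕ 2 + ε) * log ((1# - p n) ⁻¹) (fromℕ n * p n))
theorem16 lem ℝ p p∈[0,1] np→∞ qlnn→∞ ε 0<ε = n₁ ℕ.⊔ n₂ , λ n n₀≤n →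
  let
    0≤p , p≤1 = p∈[0,1] n
    X₀≤X      = ≤-respʳ-≈ (*-comm _ _) (proj₂ (np→∞ X₀) n (ℕ.m⊔n≤o⇒m≤o n₁ n₂ n₀≤n))
    M≤qlnN    = proj₂ (qlnn→∞ M) n (ℕ.m⊔n≤o⇒n≤o n₁ n₂ n₀≤n)
    R≤lnX     = ≤-trans R≤lnX₀ (ln-mono-≤ 1≤X₀ X₀≤X)
    1≤X       = ≤-trans 1≤X₀ X₀≤X
    1≤lnX     = ≤-trans 1≤R R≤lnX
    large     = ≤-respˡ-≈ (ε*[cε⁻¹+1]≈ (fromℕ 22)) (*-monoʳ-≤ (proj₁ 0<ε) R≤lnX)
    εM≈       = ε*[cε⁻¹+1]≈ (fromℕ 6)
  in u-≤ 0<ε n (p n) M 0≤p p≤1 1≤M εM≈ 1≤X 1≤lnX large M≤qlnN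
   , u′-≤ 0<ε n (p n) M 0≤p p≤1 1≤M εM≈ 1≤X 1≤lnX large M≤qlnN
  where
  open Threshold lem ℝ
  open ≤-Reasoning
  0≤ε⁻¹ = ⁻¹-nonNeg 0<ε
  -- The numbers 6 and 22 are those of `small-logs`. Adding `1#` ensures `1# ≤ M` and `1# ≤ R`, the
  -- latter giving `1# ≤ ln X`.
  M R : Carrier
  M = fromℕ 6 * ε ⁻¹ + 1#
  R = fromℕ 22 * ε ⁻¹ + 1#
  1≤M : 1# ≤ M
  1≤M = x≤y+x (*-nonNeg (fromℕ-nonNeg 6) 0≤ε⁻¹)
  1≤R : 1# ≤ R
  1≤R = x≤y+x (*-nonNeg (fromℕ-nonNeg 22) 0≤ε⁻¹)
  ε*[cε⁻¹+1]≈ : ∀ c → ε * (c * ε ⁻¹ + 1#) ≈ c + ε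
  ε*[cε⁻¹+1]≈ c = begin-equality
    ε * (c * ε ⁻¹ + 1#)      ≈⟨ solve 3 (λ e c i → e :* (c :* i :+ :1) := c :* (e :* i) :+ e) refl _ _ _ ⟩
    c * (ε * ε ⁻¹) + ε       ≈⟨ +-congʳ (trans (*-congˡ (⁻¹-inverseʳ (0<x⇒x≉0 0<ε))) (*-identityʳ c)) ⟩
    c + ε                    ∎
  unbounded = ln-unbounded R
  X₀ = proj₁ unbounded
  1≤X₀ = proj₁ (proj₂ unbounded)
  R≤lnX₀ = proj₂ (proj₂ unbounded)
  n₁ = proj₁ (np→∞ X₀)
  n₂ = proj₁ (qlnn→∞ M)
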